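{- For independent indeterminates $z$ and $v$, $$\mathcal G(z)\,\mathcal G(v)=\mathcal G(z+v-\delta zv).$$
   Context: Work over $\mathbb Q$. Let $D=\partial_x+\partial_y$, $\mathcal G_0=\mathrm{id}$ and, for $r\geq1$, $\mathcal G_r=y^r\sum_{j=1}^{r}\binom{r-1}{j-1}\frac{x^j}{j!}D^j$, as operators on $\mathbb Q[x,y]$. Put $\mathcal G(z)=\sum_{r\geq0}\mathcal G_r z^r$, a formal power series with operator coefficients; products are formed by composing operators coefficientwise. Here $\delta=y-x$ acts by multiplication, and it commutes with every $\mathcal G_r$ (because $D(y-x)=0$). The right-hand side means $\sum_{r\geq0}\mathcal G_r\,(z+v-\delta zv)^r$, a formal power series in $z,v$ with operator coefficients (well defined since $z+v-\delta zv$ has zero constant term). -}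

module Defs where

open import Algebra.Bundles using (AbelianGroup; Ring; CommutativeRing; RawRing)
open import Algebra.Module.Bundles using (LeftModule)
open import Algebra.Module.Morphism.Structures using (IsLeftModuleHomomorphism)
import Algebra.Definitions.RawMonoid
import Algebra.Definitions.RawSemiring
import Algebra.Properties.Group
import Algebra.Properties.AbelianGroup
import Algebra.Properties.CommutativeSemigroup
import Relation.Binary.Reasoning.Setoid
open import Data.Fin.Base using (Fin; zero; suc; toℕ)
open import Data.Fin.Properties using (toℕ≤pred[n])
open import Data.Integer.Base using (+_)
open import Data.Nat.Base as ℕ using (ℕ; zero; suc; _≤_; _<_; z≤n; s≤s; _∸_; _⊔_; _!)
open import Data.Nat.Combinatorics using (_C_)
import Data.Nat.Properties as ℕ
open import Data.Nat.Properties using (_!≢0)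
open import Data.Product.Base using (∃; _,_)
open import Data.Rational.Base as ℚ using (ℚ; 0ℚ; 1ℚ; _/_)
import Data.Rational.Properties as ℚ
open import Level using (Level; 0ℓ)
open import Relation.Binary.PropositionalEquality
  using (_≡_; refl; sym; trans; cong; cong₂)

module Operators {c ℓ m ℓm} (R : CommutativeRing c ℓ)
                 (M : LeftModule (CommutativeRing.ring R) m ℓm) where

  private module R = CommutativeRing R
  open LeftModule M

  private
    module G = Algebra.Properties.Group +ᴹ-group
    module AG = Algebra.Properties.AbelianGroup +ᴹ-abelianGroup
    module CS = Algebra.Properties.CommutativeSemigroup
                  (AbelianGroup.commutativeSemigroup +ᴹ-abelianGroup)
    open Relation.Binary.Reasoning.Setoid ≈ᴹ-setoid

  record Op : Set (c Level.⊔ m Level.⊔ ℓm) where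
    field
      ⟦_⟧        : Carrierᴹ → Carrierᴹ
      isLinear   : IsLeftModuleHomomorphism rawLeftModule rawLeftModule ⟦_⟧
    open IsLeftModuleHomomorphism isLinear public

  open Op public using (⟦_⟧)

  infix 4 _≈_

  record _≈_ (A B : Op) : Set (m Level.⊔ ℓm) where
    constructor ext
    field at : ∀ f → ⟦ A ⟧ f ≈ᴹ ⟦ B ⟧ f

  open _≈_ public

  mkOp : (F : Carrierᴹ → Carrierᴹ) →
         (∀ {f g} → f ≈ᴹ g → F f ≈ᴹ F g) →
         (∀ f g → F (f +ᴹ g) ≈ᴹ F f +ᴹ F g) →
         (∀ r f → F (r *ₗ f) ≈ᴹ r *ₗ F f) → Op
  mkOp F F-cong F-+ F-* = record
    { ⟦_⟧ = F
    ; isLinear = record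
      { +ᴹ-isGroupHomomorphism = record
        { isMonoidHomomorphism = record
          { isMagmaHomomorphism = record
            { isRelHomomorphism = record { cong = F-cong }
            ; homo = F-+
            }
          ; ε-homo = F-0
          }
        ; ⁻¹-homo = λ f → G.inverseʳ-unique (F f) (F (-ᴹ f)) (begin
            F f +ᴹ F (-ᴹ f)  ≈⟨ F-+ f (-ᴹ f) ⟨
            F (f +ᴹ -ᴹ f)    ≈⟨ F-cong (-ᴹ‿inverseʳ f) ⟩
            F 0ᴹ             ≈⟨ F-0 ⟩
            0ᴹ               ∎)
        }
      ; *ₗ-homo = F-*
      }
    }
    where
    F-0 : F 0ᴹ ≈ᴹ 0ᴹ
    F-0 = begin
      F 0ᴹ            ≈⟨ F-cong (*ₗ-zeroˡ 0ᴹ) ⟨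
      F (R.0# *ₗ 0ᴹ)  ≈⟨ F-* R.0# 0ᴹ ⟩
      R.0# *ₗ F 0ᴹ    ≈⟨ *ₗ-zeroˡ (F 0ᴹ) ⟩
      0ᴹ              ∎

  infixl 6 _+_
  infixl 7 _∘_
  infixr 7 _·_
  infix  8 -_

  _+_ : Op → Op → Op
  A + B = mkOp (λ f → ⟦ A ⟧ f +ᴹ ⟦ B ⟧ f)
    (λ p → +ᴹ-cong (A.⟦⟧-cong p) (B.⟦⟧-cong p))
    (λ f g → ≈ᴹ-trans (+ᴹ-cong (A.+ᴹ-homo f g) (B.+ᴹ-homo f g))
                      (CS.interchange _ _ _ _))
    (λ r f → ≈ᴹ-trans (+ᴹ-cong (A.*ₗ-homo r f) (B.*ₗ-homo r f))
                      (≈ᴹ-sym (*ₗ-distribˡ r _ _)))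
    where
    module A = Op A
    module B = Op B

  _∘_ : Op → Op → Op
  A ∘ B = mkOp (λ f → ⟦ A ⟧ (⟦ B ⟧ f))
    (λ p → A.⟦⟧-cong (B.⟦⟧-cong p))
    (λ f g → ≈ᴹ-trans (A.⟦⟧-cong (B.+ᴹ-homo f g)) (A.+ᴹ-homo _ _))
    (λ r f → ≈ᴹ-trans (A.⟦⟧-cong (B.*ₗ-homo r f)) (A.*ₗ-homo r _))
    where
    module A = Op A
    module B = Op B

  _·_ : R.Carrier → Op → Op
  s · A = mkOp (λ f → s *ₗ ⟦ A ⟧ f)
    (λ p → *ₗ-cong R.refl (A.⟦⟧-cong p))
    (λ f g → ≈ᴹ-trans (*ₗ-cong R.refl (A.+ᴹ-homo f g)) (*ₗ-distribˡ s _ _))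
    (λ r f → begin
      s *ₗ ⟦ A ⟧ (r *ₗ f)    ≈⟨ *ₗ-cong R.refl (A.*ₗ-homo r f) ⟩
      s *ₗ r *ₗ ⟦ A ⟧ f      ≈⟨ *ₗ-assoc s r _ ⟨
      (s R.* r) *ₗ ⟦ A ⟧ f   ≈⟨ *ₗ-cong (R.*-comm s r) ≈ᴹ-refl ⟩
      (r R.* s) *ₗ ⟦ A ⟧ f   ≈⟨ *ₗ-assoc r s _ ⟩
      r *ₗ s *ₗ ⟦ A ⟧ f      ∎)
    where
    module A = Op A

  -_ : Op → Op
  - A = mkOp (λ f → -ᴹ ⟦ A ⟧ f)
    (λ p → -ᴹ‿cong (A.⟦⟧-cong p))
    (λ f g → ≈ᴹ-trans (-ᴹ‿cong (A.+ᴹ-homo f g)) (≈ᴹ-sym (AG.⁻¹-∙-comm _ _)))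
    (λ r f → ≈ᴹ-trans (-ᴹ‿cong (A.*ₗ-homo r f))
      (≈ᴹ-sym (G.inverseʳ-unique _ _ (begin
        r *ₗ ⟦ A ⟧ f +ᴹ r *ₗ (-ᴹ ⟦ A ⟧ f)  ≈⟨ *ₗ-distribˡ r _ _ ⟨
        r *ₗ (⟦ A ⟧ f +ᴹ -ᴹ ⟦ A ⟧ f)       ≈⟨ *ₗ-cong R.refl (-ᴹ‿inverseʳ _) ⟩
        r *ₗ 0ᴹ                            ≈⟨ *ₗ-zeroʳ r ⟩
        0ᴹ                                 ∎))))
    where
    module A = Op A

  0ᵒ : Op
  0ᵒ = mkOp (λ _ → 0ᴹ) (λ _ → ≈ᴹ-refl) (λ _ _ → ≈ᴹ-sym (+ᴹ-identityˡ 0ᴹ))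
    (λ r _ → ≈ᴹ-sym (*ₗ-zeroʳ r))

  id : Op
  id = mkOp (λ f → f) (λ p → p) (λ _ _ → ≈ᴹ-refl) (λ _ _ → ≈ᴹ-refl)

  ring : Ring (c Level.⊔ m Level.⊔ ℓm) (m Level.⊔ ℓm)
  ring = record
    { _≈_ = _≈_ ; _+_ = _+_ ; _*_ = _∘_ ; -_ = -_ ; 0# = 0ᵒ ; 1# = id
    ; isRing = record
      { +-isAbelianGroup = record
        { isGroup = record
          { isMonoid = record
            { isSemigroup = record
              { isMagma = record
                { isEquivalence = record
                  { refl  = ext λ _ → ≈ᴹ-refl
                  ; sym   = λ p → ext λ f → ≈ᴹ-sym (at p f)
                  ; trans = λ p q → ext λ f → ≈ᴹ-trans (at p f) (at q f)
                  }
                ; ∙-cong = λ p q → ext λ f → +ᴹ-cong (at p f) (at q f)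
                }
              ; assoc = λ _ _ _ → ext λ _ → +ᴹ-assoc _ _ _
              }
            ; identity = (λ _ → ext λ _ → +ᴹ-identityˡ _)
                       , (λ _ → ext λ _ → +ᴹ-identityʳ _)
            }
          ; inverse = (λ _ → ext λ _ → -ᴹ‿inverseˡ _)
                    , (λ _ → ext λ _ → -ᴹ‿inverseʳ _)
          ; ⁻¹-cong = λ p → ext λ f → -ᴹ‿cong (at p f)
          }
        ; comm = λ _ _ → ext λ _ → +ᴹ-comm _ _
        }
      ; *-cong = λ {A} p q → ext λ f →
          ≈ᴹ-trans (Op.⟦⟧-cong A (at q f)) (at p _)
      ; *-assoc = λ _ _ _ → ext λ _ → ≈ᴹ-refl
      ; *-identity = (λ _ → ext λ _ → ≈ᴹ-refl) , (λ _ → ext λ _ → ≈ᴹ-refl)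
      ; distrib = (λ A _ _ → ext λ _ → Op.+ᴹ-homo A _ _)
                , (λ _ _ _ → ext λ _ → ≈ᴹ-refl)
      }
    }

-- Formal power series in two commuting variables z and v, with
-- coefficients in a (not necessarily commutative) ring.
module PowerSeries {c ℓ} (R : Ring c ℓ) where

  private
    module R = Ring R
    open Algebra.Definitions.RawMonoid R.+-rawMonoid using (sum)

  -- A i j is the coefficient of zⁱ vʲ.
  Series : Set c
  Series = ℕ → ℕ → R.Carrier

  infix  4 _≈_
  infixl 6 _+_ _-_
  infixl 7 _*_
  infix  8 -_

  _≈_ : Series → Series → Set ℓ
  A ≈ B = ∀ i j → A i j R.≈ B i j

  const : R.Carrier → Series
  const a zero zero = a
  const a _    _    = R.0#

  z v : Series
  z 1 0 = R.1#
  z _ _ = R.0#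
  v 0 1 = R.1#
  v _ _ = R.0#

  _+_ _-_ _*_ : Series → Series → Series
  (A + B) i j = A i j R.+ B i j
  (A - B) i j = A i j R.- B i j
  (A * B) i j = sum {suc i} λ a → sum {suc j} λ b →
    A (toℕ a) (toℕ b) R.* B (i ∸ toℕ a) (j ∸ toℕ b)

  -_ : Series → Series
  (- A) i j = R.- A i j

  rawRing : RawRing c ℓ
  rawRing = record
    { Carrier = Series ; _≈_ = _≈_ ; _+_ = _+_ ; _*_ = _*_ ; -_ = -_
    ; 0# = const R.0# ; 1# = const R.1# }

  open Algebra.Definitions.RawSemiring (RawRing.rawSemiring rawRing) public
    using (_^_)

  -- Σᵣ Aᵣ zʳ and Σᵣ Aᵣ vʳ
  in-z in-v : (ℕ → R.Carrier) → Series
  in-z A i zero    = A i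
  in-z A i (suc _) = R.0#
  in-v A zero    j = A j
  in-v A (suc _) _ = R.0#

  -- Σᵣ Aᵣ Pʳ for P with zero constant term.  The terms with r > i + j do not
  -- contribute to the coefficient of zⁱ vʲ, see ^-vanishes below;
  -- z+v-Azv-constant shows that z + v - A z v is such a P.
  infix 9 _⟨_⟩
  _⟨_⟩ : (ℕ → R.Carrier) → Series → Series
  (A ⟨ P ⟩) i j = sum {suc (i ℕ.+ j)} λ r → A (toℕ r) R.* (P ^ toℕ r) i j

  private
    sum-zero : ∀ {n} (t : Fin n → R.Carrier) →
               (∀ k → t k R.≈ R.0#) → sum t R.≈ R.0#
    sum-zero {zero}  t p = R.refl
    sum-zero {suc n} t p = R.trans
      (R.+-cong (p zero) (sum-zero (λ k → t (suc k)) (λ k → p (suc k))))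
      (R.+-identityˡ R.0#)

  ^-vanishes : ∀ P → P 0 0 R.≈ R.0# →
               ∀ r i j → i ℕ.+ j < r → (P ^ r) i j R.≈ R.0#
  ^-vanishes P P₀ (suc r) i j (s≤s i+j≤r) =
    sum-zero {suc i} _ λ a → sum-zero {suc j} _ λ b →
      term (toℕ a) (toℕ b) (toℕ≤pred[n] a) (toℕ≤pred[n] b)
    where
    smaller : ∀ a b → a ≤ i → b ≤ j → 0 < a ℕ.+ b → (i ∸ a) ℕ.+ (j ∸ b) < r
    smaller a b a≤i b≤j 0<a+b = begin-strict
      (i ∸ a) ℕ.+ (j ∸ b)                   <⟨ ℕ.m<m+n _ 0<a+b ⟩
      ((i ∸ a) ℕ.+ (j ∸ b)) ℕ.+ (a ℕ.+ b)   ≡⟨ CS.interchange (i ∸ a) (j ∸ b) a b ⟩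
      ((i ∸ a) ℕ.+ a) ℕ.+ ((j ∸ b) ℕ.+ b)   ≡⟨ cong₂ ℕ._+_ (ℕ.m∸n+n≡m a≤i) (ℕ.m∸n+n≡m b≤j) ⟩
      i ℕ.+ j                               ≤⟨ i+j≤r ⟩
      r                                     ∎
      where
      open ℕ.≤-Reasoning
      module CS = Algebra.Properties.CommutativeSemigroup ℕ.+-commutativeSemigroup

    higher : ∀ a b → a ≤ i → b ≤ j → 0 < a ℕ.+ b →
             P a b R.* (P ^ r) (i ∸ a) (j ∸ b) R.≈ R.0#
    higher a b p q 0<a+b = R.trans
      (R.*-cong R.refl (^-vanishes P P₀ r (i ∸ a) (j ∸ b) (smaller a b p q 0<a+b)))
      (R.zeroʳ _)

    term : ∀ a b → a ≤ i → b ≤ j →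
           P a b R.* (P ^ r) (i ∸ a) (j ∸ b) R.≈ R.0#
    term zero    zero    _ _ = R.trans (R.*-cong P₀ R.refl) (R.zeroˡ _)
    term zero    (suc b) p q = higher zero (suc b) p q (s≤s z≤n)
    term (suc a) b       p q = higher (suc a) b p q (s≤s z≤n)

  z+v-Azv-constant : ∀ A → (z + v - A * z * v) 0 0 R.≈ R.0#
  z+v-Azv-constant A = begin
    (R.0# R.+ R.0#) R.- (A * z * v) 0 0  ≈⟨ R.+-cong (R.+-identityˡ _) (R.-‿cong Azv₀) ⟩
    R.0# R.- R.0#                        ≈⟨ R.-‿inverseʳ _ ⟩
    R.0#                                 ∎
    where
    open Relation.Binary.Reasoning.Setoid R.setoid
    Azv₀ : (A * z * v) 0 0 R.≈ R.0#
    Azv₀ = R.trans (R.+-identityʳ _) (R.trans (R.+-identityʳ _) (R.zeroʳ _))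

-- coeff i j is the coefficient of xⁱ yʲ.
record Poly : Set where
  constructor poly
  field
    coeff   : ℕ → ℕ → ℚ
    bounded : ∃ λ N → ∀ i j → N ≤ i ℕ.+ j → coeff i j ≡ 0ℚ

open Poly public

infix 4 _≈ᴾ_

record _≈ᴾ_ (f g : Poly) : Set where
  constructor ext
  field at : ∀ i j → coeff f i j ≡ coeff g i j

open _≈ᴾ_ public

ℚ[x,y] : LeftModule ℚ.+-*-ring 0ℓ 0ℓ
ℚ[x,y] = record
  { Carrierᴹ = Poly
  ; _≈ᴹ_ = _≈ᴾ_
  ; _+ᴹ_ = λ { (poly f (M , p)) (poly g (N , q)) →
      poly (λ i j → f i j ℚ.+ g i j)
           (M ⊔ N , λ i j le → cong₂ ℚ._+_
              (p i j (ℕ.≤-trans (ℕ.m≤m⊔n M N) le))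
              (q i j (ℕ.≤-trans (ℕ.m≤n⊔m M N) le))) }
  ; _*ₗ_ = λ { s (poly f (N , p)) →
      poly (λ i j → s ℚ.* f i j)
           (N , λ i j le → trans (cong (s ℚ.*_) (p i j le)) (ℚ.*-zeroʳ s)) }
  ; 0ᴹ = poly (λ _ _ → 0ℚ) (0 , λ _ _ _ → refl)
  ; -ᴹ_ = λ { (poly f (N , p)) →
      poly (λ i j → ℚ.- f i j) (N , λ i j le → cong ℚ.-_ (p i j le)) }
  ; isLeftModule = record
    { isLeftSemimodule = record
      { +ᴹ-isCommutativeMonoid = record
        { isMonoid = record
          { isSemigroup = record
            { isMagma = record
              { isEquivalence = record
                { refl  = ext λ _ _ → refl
                ; sym   = λ p → ext λ i j → sym (at p i j)
                ; trans = λ p q → ext λ i j → trans (at p i j) (at q i j)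
                }
              ; ∙-cong = λ p q → ext λ i j → cong₂ ℚ._+_ (at p i j) (at q i j)
              }
            ; assoc = λ f g h → ext λ i j →
                ℚ.+-assoc (coeff f i j) (coeff g i j) (coeff h i j)
            }
          ; identity = (λ f → ext λ i j → ℚ.+-identityˡ (coeff f i j))
                     , (λ f → ext λ i j → ℚ.+-identityʳ (coeff f i j))
          }
        ; comm = λ f g → ext λ i j → ℚ.+-comm (coeff f i j) (coeff g i j)
        }
      ; isPreleftSemimodule = record
        { *ₗ-cong = λ p q → ext λ i j → cong₂ ℚ._*_ p (at q i j)
        ; *ₗ-zeroˡ = λ f → ext λ i j → ℚ.*-zeroˡ (coeff f i j)
        ; *ₗ-distribʳ = λ f r s → ext λ i j → ℚ.*-distribʳ-+ (coeff f i j) r s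
        ; *ₗ-identityˡ = λ f → ext λ i j → ℚ.*-identityˡ (coeff f i j)
        ; *ₗ-assoc = λ r s f → ext λ i j → ℚ.*-assoc r s (coeff f i j)
        ; *ₗ-zeroʳ = λ r → ext λ i j → ℚ.*-zeroʳ r
        ; *ₗ-distribˡ = λ r f g → ext λ i j →
            ℚ.*-distribˡ-+ r (coeff f i j) (coeff g i j)
        }
      }
    ; -ᴹ‿cong = λ p → ext λ i j → cong ℚ.-_ (at p i j)
    ; -ᴹ‿inverse = (λ f → ext λ i j → ℚ.+-inverseˡ (coeff f i j))
                 , (λ f → ext λ i j → ℚ.+-inverseʳ (coeff f i j))
    }
  }

module Operator = Operators ℚ.+-*-commutativeRing ℚ[x,y]

open Operator using (Op; mkOp; _∘_; _·_; id)

private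
  module OpRing = Ring Operator.ring
  open OpRing using (_+_; _-_)
  open Algebra.Definitions.RawSemiring
    (RawRing.rawSemiring OpRing.rawRing) using (sum; _^_)

-- Multiplication by x and by y
X Y : Op
X = mkOp shift (λ p → ext λ { zero j → refl ; (suc i) j → at p i j })
    (λ _ _ → ext λ { zero j → refl ; (suc i) j → refl })
    (λ r _ → ext λ { zero j → sym (ℚ.*-zeroʳ r) ; (suc i) j → refl })
  where
  shift : Poly → Poly
  shift (poly f (N , p)) = poly f′ (suc N , p′)
    where
    f′ : ℕ → ℕ → ℚ
    f′ zero    j = 0ℚ
    f′ (suc i) j = f i j
    p′ : ∀ i j → suc N ≤ i ℕ.+ j → f′ i j ≡ 0ℚ
    p′ zero    j _        = refl
    p′ (suc i) j (s≤s le) = p i j le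

Y = mkOp shift (λ p → ext λ { i zero → refl ; i (suc j) → at p i j })
    (λ _ _ → ext λ { i zero → refl ; i (suc j) → refl })
    (λ r _ → ext λ { i zero → sym (ℚ.*-zeroʳ r) ; i (suc j) → refl })
  where
  shift : Poly → Poly
  shift (poly f (N , p)) = poly f′ (suc N , p′)
    where
    f′ : ℕ → ℕ → ℚ
    f′ i zero    = 0ℚ
    f′ i (suc j) = f i j
    p′ : ∀ i j → suc N ≤ i ℕ.+ j → f′ i j ≡ 0ℚ
    p′ i zero    _  = refl
    p′ i (suc j) le = p i j (ℕ.≤-pred (ℕ.≤-trans le (ℕ.≤-reflexive (ℕ.+-suc i j))))

fromℕ : ℕ → ℚ
fromℕ n = + n / 1

private
  *-swap : ∀ p q r → p ℚ.* (q ℚ.* r) ≡ q ℚ.* (p ℚ.* r)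
  *-swap = CS.x∙yz≈y∙xz
    where
    module CS = Algebra.Properties.CommutativeSemigroup
                        (CommutativeRing.*-commutativeSemigroup ℚ.+-*-commutativeRing)

∂x ∂y : Op
∂x = mkOp
  (λ { (poly f (N , p)) → poly (λ i j → fromℕ (suc i) ℚ.* f (suc i) j)
         (N , λ i j le → trans
           (cong (fromℕ (suc i) ℚ.*_) (p (suc i) j (ℕ.m≤n⇒m≤1+n le)))
           (ℚ.*-zeroʳ (fromℕ (suc i)))) })
  (λ p → ext λ i j → cong (fromℕ (suc i) ℚ.*_) (at p (suc i) j))
  (λ f g → ext λ i j →
    ℚ.*-distribˡ-+ (fromℕ (suc i)) (coeff f (suc i) j) (coeff g (suc i) j))
  (λ r f → ext λ i j → *-swap (fromℕ (suc i)) r (coeff f (suc i) j))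
∂y = mkOp
  (λ { (poly f (N , p)) → poly (λ i j → fromℕ (suc j) ℚ.* f i (suc j))
         (N , λ i j le → trans
           (cong (fromℕ (suc j) ℚ.*_) (p i (suc j)
             (ℕ.≤-trans le (ℕ.+-monoʳ-≤ i (ℕ.n≤1+n j)))))
           (ℚ.*-zeroʳ (fromℕ (suc j)))) })
  (λ p → ext λ i j → cong (fromℕ (suc j) ℚ.*_) (at p i (suc j)))
  (λ f g → ext λ i j →
    ℚ.*-distribˡ-+ (fromℕ (suc j)) (coeff f i (suc j)) (coeff g i (suc j)))
  (λ r f → ext λ i j → *-swap (fromℕ (suc j)) r (coeff f i (suc j)))

D δ : Op
D = ∂x + ∂y
δ = Y - X

-- For r = suc n the summation index is j = suc k with 0 ≤ k ≤ n.
𝒢 : ℕ → Op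
𝒢 zero    = id
𝒢 (suc n) = Y ^ suc n ∘ sum {suc n} λ k →
  let j = suc (toℕ k) in
  ((+ (n C toℕ k)) / (j !)) {{j !≢0}} · (X ^ j ∘ D ^ j)

module OpSeries = PowerSeries Operator.ring

-- An operator is determined by its value at 1 once its commutators with δ and with
-- multiplication by x are known, because 1 generates ℚ[x,y] under x and δ = y - x.
-- All the operators involved commute with δ.  Pascal's rule and [D,x] = 1 give
-- (1 - yz) 𝒢(z) x = x 𝒢(z), that is 𝒢ₙ x = x 𝒢ₙ + y 𝒢ₙ₋₁ x.  Put w = z + v - δzv.
-- Since 𝒢(z) y = 𝒢(z) (x + δ) and (1 - yz) - y (1 - δz) v = 1 - yw, it follows that
-- (1 - yw) H x = x H for H = 𝒢(z) 𝒢(v); as w is central, the same holds for H = 𝒢(w).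
-- Both series map 1 to 1, and the relation determines their coefficients
-- recursively.  The truncations Σ_{r<N} 𝒢ᵣ wʳ agree with 𝒢(w) in total degree below N.

module Submission where

open import Defs
open import Algebra.Bundles using (RawRing; Ring)
open import Algebra.Module.Bundles using (LeftModule)
import Algebra.Definitions.RawSemiring
import Algebra.Properties.CommutativeMonoid.Mult
import Algebra.Properties.Ring
import Algebra.Properties.Semiring.Mult
import Algebra.Properties.Semiring.Sum
import Relation.Binary.Reasoning.Setoid
open import Data.Fin.Base as Fin using (Fin; toℕ)
open import Data.Fin.Properties using (toℕ<n)
open import Data.Integer.Base as ℤ using (+_)
import Data.Integer.Properties as ℤ
open import Data.Nat.Base as ℕ using (ℕ; zero; suc; _∸_; _!; NonZero)
open import Data.Nat.Combinatorics using (_C_; nCk+nC[k+1]≡[n+1]C[k+1]; k>n⇒nCk≡0)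
import Data.Nat.Properties as ℕ
open import Data.Nat.Properties using (_!≢0)
open import Data.Product.Base using (_,_)
open import Data.Rational.Base as ℚ using (ℚ; 0ℚ; 1ℚ; _/_)
import Data.Rational.Properties as ℚ
import Data.Rational.Unnormalised.Base as ℚᵘ
import Data.Rational.Unnormalised.Properties as ℚᵘ
import Relation.Binary.PropositionalEquality as ≡
open ≡ using (_≡_)

-- Finite sums, binomial sums and commuting elements in a ring

module RingSums {c ℓ} (R : Ring c ℓ) where
  open Ring R hiding (zero)
  open Algebra.Properties.Ring R
  open Algebra.Properties.Semiring.Sum semiring
  open Algebra.Properties.Semiring.Mult semiring
  open Algebra.Properties.CommutativeMonoid.Mult +-commutativeMonoid using (×-distrib-+)
  open Relation.Binary.Reasoning.Setoid setoid

  -- Opaque, so that the summand can be recovered by unification.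
  opaque
    ∑ : ℕ → (ℕ → Carrier) → Carrier
    ∑ n f = sum {n} (λ k → f (toℕ k))

  opaque
    unfolding ∑

    ∑-def : ∀ n f → ∑ n f ≈ sum {n} (λ k → f (toℕ k))
    ∑-def n f = refl

    ∑-cong : ∀ n {f g} → (∀ k → f k ≈ g k) → ∑ n f ≈ ∑ n g
    ∑-cong n f≈g = sum-cong-≋ {n} λ k → f≈g (toℕ k)

    ∑-0 : ∀ n {f} → (∀ k → k ℕ.< n → f k ≈ 0#) → ∑ n f ≈ 0#
    ∑-0 n f≈0 = trans (sum-cong-≋ {n} λ k → f≈0 (toℕ k) (toℕ<n k)) (sum-replicate-zero n)

    ∑-suc : ∀ n f → ∑ (suc n) f ≈ f 0 + ∑ n (λ k → f (suc k))
    ∑-suc n f = refl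

    ∑-snoc : ∀ n f → ∑ (suc n) f ≈ ∑ n f + f n
    ∑-snoc zero    f = +-comm (f 0) 0#
    ∑-snoc (suc n) f = trans (+-congˡ (∑-snoc n (λ k → f (suc k)))) (sym (+-assoc _ _ _))

    ∑-+ : ∀ n f g → ∑ n (λ k → f k + g k) ≈ ∑ n f + ∑ n g
    ∑-+ n f g = ∑-distrib-+ {n} (λ k → f (toℕ k)) (λ k → g (toℕ k))

    *-∑ : ∀ n a f → a * ∑ n f ≈ ∑ n (λ k → a * f k)
    *-∑ n a f = *-distribˡ-sum {n} a (λ k → f (toℕ k))

    ∑-* : ∀ n a f → ∑ n f * a ≈ ∑ n (λ k → f k * a)
    ∑-* n a f = *-distribʳ-sum {n} a (λ k → f (toℕ k))

  -- On coefficients, multiplication of a generating function by its variable.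
  shift : (ℕ → Carrier) → ℕ → Carrier
  shift f zero    = 0#
  shift f (suc n) = f n

  shift-cong : ∀ {f g} → (∀ n → f n ≈ g n) → ∀ n → shift f n ≈ shift g n
  shift-cong f≈g zero    = refl
  shift-cong f≈g (suc n) = f≈g n

  shift-*ˡ : ∀ a f n → shift (λ k → a * f k) n ≈ a * shift f n
  shift-*ˡ a f zero    = sym (zeroʳ a)
  shift-*ˡ a f (suc n) = refl

  shift-*ʳ : ∀ a f n → shift (λ k → f k * a) n ≈ shift f n * a
  shift-*ʳ a f zero    = sym (zeroˡ a)
  shift-*ʳ a f (suc n) = refl

  shift-∑ : ∀ m (f : ℕ → ℕ → Carrier) n → shift (λ k → ∑ m (λ r → f r k)) n ≈ ∑ m (λ r → shift (f r) n)
  shift-∑ m f zero    = sym (∑-0 m λ _ _ → refl)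
  shift-∑ m f (suc n) = refl

  -- A factor of degree at most one leaves two summands of the Cauchy product. For `n = 0` the
  -- second is absent, which matches `shift f 0 = 0#`.
  convolve-two-terms : ∀ n (t f : ℕ → Carrier) → (∀ k → t (2 ℕ.+ k) ≈ 0#) →
    sum {suc n} (λ k → t (toℕ k) * f (n ∸ toℕ k)) ≈ t 0 * f n + t 1 * shift f n
  convolve-two-terms zero    t f t≈0 = +-congˡ (sym (zeroʳ (t 1)))
  convolve-two-terms (suc n) t f t≈0 = +-congˡ (trans
    (+-congˡ (trans (sum-cong-≋ {n} λ k → trans (*-congʳ (t≈0 (toℕ k))) (zeroˡ _))
                    (sum-replicate-zero n)))
    (+-identityʳ _))

  binomial : ℕ → (ℕ → Carrier) → Carrier
  binomial n T = ∑ (suc n) λ k → (n C k) × T k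

  binomial-cong : ∀ n {S T} → (∀ k → S k ≈ T k) → binomial n S ≈ binomial n T
  binomial-cong n S≈T = ∑-cong (suc n) λ k → ×-congʳ (n C k) (S≈T k)

  *-binomial : ∀ n a T → a * binomial n T ≈ binomial n (λ k → a * T k)
  *-binomial n a T = trans (*-∑ (suc n) a _)
    (∑-cong (suc n) λ k → ×-comm-* (n C k) a (T k))

  binomial-* : ∀ n a T → binomial n T * a ≈ binomial n (λ k → T k * a)
  binomial-* n a T = trans (∑-* (suc n) a _)
    (∑-cong (suc n) λ k → ×-assoc-* (n C k) (T k) a)

  binomial-+ : ∀ n S T → binomial n (λ k → S k + T k) ≈ binomial n S + binomial n T
  binomial-+ n S T = trans
    (∑-cong (suc n) λ k → ×-distrib-+ (S k) (T k) (n C k))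
    (∑-+ (suc n) _ _)

  -- Pascal's rule splits every term but the first; since `n C suc n` is 0, both pieces run over row
  -- `n`.
  binomial-suc : ∀ n T → binomial (suc n) T ≈ binomial n T + binomial n (λ k → T (suc k))
  binomial-suc n T = begin
    binomial (suc n) T
      ≈⟨ ∑-suc (suc n) _ ⟩
    1 × T 0 + ∑ (suc n) (λ k → (suc n C suc k) × T′ k)
      ≈⟨ +-congˡ (∑-cong (suc n) pascal) ⟩
    1 × T 0 + ∑ (suc n) (λ k → (n C k) × T′ k + u k)
      ≈⟨ +-congˡ (∑-+ (suc n) _ _) ⟩
    1 × T 0 + (binomial n T′ + ∑ (suc n) u)
      ≈⟨ +-congˡ (+-congˡ (trans (∑-snoc n u) (trans (+-congˡ u-n) (+-identityʳ _)))) ⟩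
    1 × T 0 + (binomial n T′ + ∑ n u)
      ≈⟨ trans (+-congˡ (+-comm _ _)) (sym (+-assoc _ _ _)) ⟩
    1 × T 0 + ∑ n u + binomial n T′
      ≈⟨ +-congʳ (∑-suc n _) ⟨
    binomial n T + binomial n T′ ∎
    where
    T′ u : ℕ → Carrier
    T′ k = T (suc k)
    u k = (n C suc k) × T′ k
    pascal : ∀ k → (suc n C suc k) × T′ k ≈ (n C k) × T′ k + u k
    pascal k = trans (×-congˡ (≡.sym (nCk+nC[k+1]≡[n+1]C[k+1] n k)))
                     (×-homo-+ (T′ k) (n C k) (n C suc k))
    u-n : u n ≈ 0#
    u-n = ×-congˡ (k>n⇒nCk≡0 (ℕ.n<1+n n))

  Commutes : Carrier → Carrier → Set ℓ
  Commutes a b = a * b ≈ b * a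

  commutes-0 : ∀ a → Commutes a 0#
  commutes-0 a = trans (zeroʳ a) (sym (zeroˡ a))

  commutes-1 : ∀ a → Commutes a 1#
  commutes-1 a = trans (*-identityʳ a) (sym (*-identityˡ a))

  commutes-+ : ∀ {a b c} → Commutes a b → Commutes a c → Commutes a (b + c)
  commutes-+ {a} {b} {c} p q =
    trans (distribˡ a b c) (trans (+-cong p q) (sym (distribʳ a b c)))

  commutes-* : ∀ {a b c} → Commutes a b → Commutes a c → Commutes a (b * c)
  commutes-* {a} {b} {c} p q = begin
    a * (b * c)  ≈⟨ *-assoc a b c ⟨
    a * b * c    ≈⟨ *-congʳ p ⟩
    b * a * c    ≈⟨ *-assoc b a c ⟩
    b * (a * c)  ≈⟨ *-congˡ q ⟩
    b * (c * a)  ≈⟨ *-assoc b c a ⟨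
    b * c * a    ∎

  commutes-neg : ∀ {a b} → Commutes a b → Commutes a (- b)
  commutes-neg {a} {b} p =
    trans (sym (-‿distribʳ-* a b)) (trans (-‿cong p) (-‿distribˡ-* b a))

  commutes-∑ : ∀ n {a f} → (∀ k → Commutes a (f k)) → Commutes a (∑ n f)
  commutes-∑ n p = trans (*-∑ n _ _) (trans (∑-cong n p) (sym (∑-* n _ _)))

  commutes-shift : ∀ {a} (f : ℕ → Carrier) → (∀ k → Commutes a (f k)) → ∀ n → Commutes a (shift f n)
  commutes-shift {a} f p zero    = commutes-0 a
  commutes-shift     f p (suc n) = p n

-- Power series in z and v, and multiplication by w = z + v - δzv

module Substitution {c ℓ} (R : Ring c ℓ) (δ : Ring.Carrier R) where
  open Ring R hiding (zero)
  open Algebra.Properties.Ring R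
  open Algebra.Properties.Semiring.Sum semiring
  open Relation.Binary.Reasoning.Setoid setoid
  open RingSums R public
  open PowerSeries R using (Series; const; z; v; in-z; in-v; _⟨_⟩)
    renaming (_*_ to _⊛_; _+_ to _⊕_; _-_ to _⊖_; _^_ to _^ˢ_)

  ⊛-cong : ∀ {A B F G : Series} → (∀ i j → A i j ≈ F i j) → (∀ i j → B i j ≈ G i j) →
           ∀ i j → (A ⊛ B) i j ≈ (F ⊛ G) i j
  ⊛-cong A≈F B≈G i j = sum-cong-≋ {suc i} λ a → sum-cong-≋ {suc j} λ b →
    *-cong (A≈F (toℕ a) (toℕ b)) (B≈G (i ∸ toℕ a) (j ∸ toℕ b))

  ^-cong : ∀ {P Q : Series} → (∀ i j → P i j ≈ Q i j) → ∀ r i j → (P ^ˢ r) i j ≈ (Q ^ˢ r) i j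
  ^-cong P≈Q zero    i j = refl
  ^-cong P≈Q (suc r) i j = ⊛-cong P≈Q (^-cong P≈Q r) i j

  -- On coefficients, multiplication by z, by v and by zv.
  shift₁ shift₂ shift₁₂ : Series → Series
  shift₁  F i j = shift (λ a → F a j) i
  shift₂  F i j = shift (F i) j
  shift₁₂ F i j = shift (λ a → shift (F a) j) i

  -- Since `P` has degree at most one in each variable, the two-term convolution applies first in v,
  -- for each power of z, and then in z.
  convolve-square : ∀ (P F : Series) → (∀ a b → P (2 ℕ.+ a) b ≈ 0#) → (∀ a b → P a (2 ℕ.+ b) ≈ 0#) →
    ∀ i j → (P ⊛ F) i j ≈ (P 0 0 * F i j + P 1 0 * shift₁ F i j)
                        + (P 0 1 * shift₂ F i j + P 1 1 * shift₁₂ F i j)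
  convolve-square P F p q i j = begin
    (P ⊛ F) i j
      ≈⟨ (sum-cong-≋ {suc i} λ a → convolve-two-terms j (P (toℕ a)) (F (i ∸ toℕ a)) (q (toℕ a))) ⟩
    sum {suc i} (λ a → s (toℕ a) + t (toℕ a))
      ≈⟨ ∑-distrib-+ {suc i} (λ a → s (toℕ a)) (λ a → t (toℕ a)) ⟩
    sum {suc i} (λ a → s (toℕ a)) + sum {suc i} (λ a → t (toℕ a))
      ≈⟨ +-cong (convolve-two-terms i (λ a → P a 0) (λ a → F a j) (λ a → p a 0))
                (convolve-two-terms i (λ a → P a 1) (λ a → shift (F a) j) (λ a → p a 1)) ⟩
    _ ∎
    where
    s t : ℕ → Carrier
    s a = P a 0 * F (i ∸ a) j
    t a = P a 1 * shift (F (i ∸ a)) j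

  const-* : ∀ a F i j → (const a ⊛ F) i j ≈ a * F i j
  const-* a F i j = begin
    (const a ⊛ F) i j
      ≈⟨ convolve-square (const a) F (λ _ _ → refl) (λ { zero _ → refl ; (suc _) _ → refl }) i j ⟩
    (a * F i j + 0# * _) + (0# * _ + 0# * _)
      ≈⟨ +-cong (+-congˡ (zeroˡ _)) (+-cong (zeroˡ _) (zeroˡ _)) ⟩
    (a * F i j + 0#) + (0# + 0#)
      ≈⟨ +-cong (+-identityʳ _) (+-identityˡ 0#) ⟩
    a * F i j + 0#
      ≈⟨ +-identityʳ _ ⟩
    a * F i j ∎

  w : Series
  w = z ⊕ v ⊖ const δ ⊛ z ⊛ v

  z-suc : ∀ a b → z a (suc b) ≈ 0#
  z-suc 0 b = refl
  z-suc 1 b = refl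
  z-suc (suc (suc a)) b = refl

  v-2 : ∀ a b → v a (2 ℕ.+ b) ≈ 0#
  v-2 zero    b = refl
  v-2 (suc a) b = refl

  δz : Series
  δz = const δ ⊛ z

  δz-0 : ∀ i j → z i j ≈ 0# → δz i j ≈ 0#
  δz-0 i j eq = trans (const-* δ z i j) (trans (*-congˡ eq) (zeroʳ δ))

  δzv : ∀ i j → (δz ⊛ v) i j ≈ δ * shift₁ v i j
  δzv i j = begin
    (δz ⊛ v) i j
      ≈⟨ convolve-square δz v (λ a b → δz-0 (2 ℕ.+ a) b refl) (λ a b → δz-0 a (2 ℕ.+ b) (z-suc a (suc b))) i j ⟩
    (δz 0 0 * _ + δz 1 0 * shift₁ v i j) + (δz 0 1 * _ + δz 1 1 * _)
      ≈⟨ +-cong (+-cong (*-congʳ (δz-0 0 0 refl)) (*-congʳ (trans (const-* δ z 1 0) (*-identityʳ δ))))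
                (+-cong (*-congʳ (δz-0 0 1 refl)) (*-congʳ (δz-0 1 1 refl))) ⟩
    (0# * _ + δ * shift₁ v i j) + (0# * _ + 0# * _)
      ≈⟨ +-cong (+-congʳ (zeroˡ _)) (+-cong (zeroˡ _) (zeroˡ _)) ⟩
    (0# + δ * shift₁ v i j) + (0# + 0#)
      ≈⟨ +-cong (+-identityˡ _) (+-identityˡ 0#) ⟩
    δ * shift₁ v i j + 0#
      ≈⟨ +-identityʳ _ ⟩
    δ * shift₁ v i j ∎

  w-coeff : ∀ i j {a b} → z i j + v i j ≈ a → shift₁ v i j ≈ b → w i j ≈ a + - (δ * b)
  w-coeff i j p q = +-cong p (-‿cong (trans (δzv i j) (*-congˡ q)))

  x-δ0≈x : ∀ {x} → x + - (δ * 0#) ≈ x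
  x-δ0≈x {x} = trans (+-congˡ (trans (-‿cong (zeroʳ δ)) -0#≈0#)) (+-identityʳ x)

  w-0 : ∀ i j → z i j + v i j ≈ 0# → shift₁ v i j ≈ 0# → w i j ≈ 0#
  w-0 i j p q = trans (w-coeff i j p q) x-δ0≈x

  infixr 8 W_
  -- The product w F written out as zF + vF - δzvF, as `w-*` confirms.
  W_ : Series → Series
  (W F) i j = shift₁ F i j + (shift₂ F i j + - δ * shift₁₂ F i j)

  w-* : ∀ F i j → (w ⊛ F) i j ≈ (W F) i j
  w-* F i j = begin
    (w ⊛ F) i j
      ≈⟨ convolve-square w F
           (λ a b → w-0 (2 ℕ.+ a) b (+-identityˡ 0#) refl)
           (λ a b → w-0 a (2 ℕ.+ b) (trans (+-cong (z-suc a (suc b)) (v-2 a b)) (+-identityˡ 0#))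
                                    (shift₁v a b)) i j ⟩
    (w 0 0 * _ + w 1 0 * _) + (w 0 1 * _ + w 1 1 * _)
      ≈⟨ +-cong (+-cong (*-congʳ (w-0 0 0 (+-identityˡ 0#) refl))
                        (*-congʳ (trans (w-coeff 1 0 (+-identityʳ 1#) refl) x-δ0≈x)))
                (+-cong (*-congʳ (trans (w-coeff 0 1 (+-identityˡ 1#) refl) x-δ0≈x))
                        (*-congʳ (trans (w-coeff 1 1 (+-identityˡ 0#) refl)
                          (trans (+-identityˡ _) (-‿cong (*-identityʳ δ)))))) ⟩
    (0# * _ + 1# * _) + (1# * _ + - δ * _)
      ≈⟨ +-cong (trans (+-cong (zeroˡ _) (*-identityˡ _)) (+-identityˡ _)) (+-congʳ (*-identityˡ _)) ⟩
    (W F) i j ∎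
    where
    shift₁v : ∀ a b → shift₁ v a (2 ℕ.+ b) ≈ 0#
    shift₁v zero    b = refl
    shift₁v (suc a) b = v-2 a b

  -- Because w has no constant term, a coefficient of w F involves only coefficients of F of smaller
  -- total degree. This is what makes the relation with x a recursion.
  W-cong : ∀ {F G} i j → (∀ a b → a ℕ.+ b ℕ.< i ℕ.+ j → F a b ≈ G a b) → (W F) i j ≈ (W G) i j
  W-cong zero zero F≈G = refl
  W-cong zero (suc j) F≈G = +-congˡ (+-congʳ (F≈G zero j ℕ.≤-refl))
  W-cong (suc i) zero F≈G = +-congʳ (F≈G i zero ℕ.≤-refl)
  W-cong (suc i) (suc j) F≈G = +-cong (F≈G i (suc j) ℕ.≤-refl)
    (+-cong (F≈G (suc i) j (ℕ.≤-reflexive (≡.cong suc (≡.sym (ℕ.+-suc i j)))))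
            (*-congˡ (F≈G i j (ℕ.s≤s (ℕ.+-monoʳ-≤ i (ℕ.n≤1+n j))))))

  w^ : ℕ → Series
  w^ r = w ^ˢ r

  -- The coefficients of wʳ are polynomials in δ with integer coefficients.
  commutes-w^ : ∀ {a} → Commutes a δ → ∀ r i j → Commutes a (w^ r i j)
  commutes-w^ {a} p zero zero    zero    = commutes-1 a
  commutes-w^ {a} p zero zero    (suc j) = commutes-0 a
  commutes-w^ {a} p zero (suc i) j       = commutes-0 a
  commutes-w^ {a} p (suc r) i j = trans (*-congˡ (w-* (w^ r) i j)) (trans
    (commutes-+ (commutes-shift _ (λ k → commutes-w^ p r k j) i)
      (commutes-+ (commutes-shift _ (λ k → commutes-w^ p r i k) j)
        (commutes-* (commutes-neg p)
          (commutes-shift _ (λ k → commutes-shift _ (commutes-w^ p r k) j) i))))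
    (*-congʳ (sym (w-* (w^ r) i j))))

  -- Truncations of the substituted series Σ gᵣ wʳ

  module _ (g : ℕ → Carrier) (gδ : ∀ r → Commutes (g r) δ) where

    partial : ℕ → Series
    partial N i j = ∑ N λ r → g r * w^ r i j

    -- The new factor w stands to the right of `g r`; it moves to the front because `g r` commutes
    -- with δ.
    W-partial : ∀ N i j →
      ∑ N (λ r → g r * w^ (suc r) i j) ≈ (W (partial N)) i j
    W-partial N i j = begin
      ∑ N (λ r → g r * w^ (suc r) i j)
        ≈⟨ ∑-cong N term ⟩
      ∑ N (λ r → A r + (B r + - δ * E r))
        ≈⟨ ∑-+ N _ _ ⟩
      ∑ N (λ r → A r) + ∑ N (λ r → B r + - δ * E r)
        ≈⟨ +-congˡ (∑-+ N _ _) ⟩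
      ∑ N (λ r → A r) + (∑ N (λ r → B r) + ∑ N (λ r → - δ * E r))
        ≈⟨ +-cong (shift-∑ N _ i) (+-cong (shift-∑ N _ j)
             (trans (*-congˡ (trans (shift-cong (λ _ → shift-∑ N _ j) i) (shift-∑ N _ i)))
                    (*-∑ N (- δ) _))) ⟨
      (W (partial N)) i j ∎
      where
      A B E : ℕ → Carrier
      A r = shift (λ a → g r * w^ r a j) i
      B r = shift (λ b → g r * w^ r i b) j
      E r = shift (λ a → shift (λ b → g r * w^ r a b) j) i
      term : ∀ r → g r * w^ (suc r) i j ≈ A r + (B r + - δ * E r)
      term r = begin
        g r * w^ (suc r) i j
          ≈⟨ *-congˡ (w-* (w^ r) i j) ⟩
        g r * (W (w^ r)) i j
          ≈⟨ trans (distribˡ _ _ _) (+-congˡ (distribˡ _ _ _)) ⟩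
        g r * shift₁ (w^ r) i j + (g r * shift₂ (w^ r) i j + g r * (- δ * shift₁₂ (w^ r) i j))
          ≈⟨ +-cong (shift-*ˡ (g r) _ i) (+-cong (shift-*ˡ (g r) _ j)
               (trans (*-congˡ (trans (shift-cong (λ _ → shift-*ˡ (g r) _ j) i) (shift-*ˡ (g r) _ i)))
                 (trans (sym (*-assoc _ _ _)) (trans (*-congʳ (sym (commutes-neg (gδ r)))) (*-assoc _ _ _))))) ⟨
        A r + (B r + - δ * E r) ∎

    commutes-partial : ∀ {a} → (∀ r → Commutes (g r) a) → Commutes a δ →
                       ∀ N i j → Commutes (partial N i j) a
    commutes-partial ga aδ N i j =
      sym (commutes-∑ N λ r → commutes-* (sym (ga r)) (commutes-w^ aδ r i j))

    -- The relation (1 - yw) H x = x H for truncations and for products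

    module Multiplication (X Y : Carrier) (Xδ : Commutes X δ) (Y≈X+δ : Y ≈ X + δ)
             (gX : ∀ r → g r * X ≈ X * g r + Y * (shift g r * X)) where

      -- Sum of the relations `gX r`, multiplied by wʳ, over r ≤ N. The shift of `g` costs one term,
      -- so the remainder contains the shorter truncation `partial N`.
      partial-X : ∀ N i j → partial (suc N) i j * X
                          ≈ X * partial (suc N) i j + Y * ((W (partial N)) i j * X)
      partial-X N i j = begin
        partial (suc N) i j * X
          ≈⟨ ∑-* (suc N) X _ ⟩
        ∑ (suc N) (λ r → g r * w^ r i j * X)
          ≈⟨ ∑-cong (suc N) term ⟩
        ∑ (suc N) (λ r → X * (g r * w^ r i j) + Y * (u r * X))
          ≈⟨ ∑-+ (suc N) _ _ ⟩
        ∑ (suc N) (λ r → X * (g r * w^ r i j)) + ∑ (suc N) (λ r → Y * (u r * X))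
          ≈⟨ +-cong (*-∑ (suc N) X _)
               (trans (*-congˡ (∑-* (suc N) X _)) (*-∑ (suc N) Y _)) ⟨
        X * partial (suc N) i j + Y * (∑ (suc N) (λ r → u r) * X)
          -- The term r = 0 vanishes because `shift g 0` is 0; reindexing the others raises the
          -- power of w by one.
          ≈⟨ +-congˡ (*-congˡ (*-congʳ (trans (∑-suc N u) (trans (+-congʳ (zeroˡ _)) (+-identityˡ _))))) ⟩
        X * partial (suc N) i j + Y * (∑ N (λ r → g r * w^ (suc r) i j) * X)
          ≈⟨ +-congˡ (*-congˡ (*-congʳ (W-partial N i j))) ⟩
        X * partial (suc N) i j + Y * ((W (partial N)) i j * X) ∎
        where
        u : ℕ → Carrier
        u r = shift g r * w^ r i j
        term : ∀ r → g r * w^ r i j * X ≈ X * (g r * w^ r i j) + Y * (u r * X)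
        term r = begin
          g r * w^ r i j * X
            ≈⟨ trans (*-assoc _ _ _) (*-congˡ (sym (commutes-w^ Xδ r i j))) ⟩
          g r * (X * w^ r i j)
            ≈⟨ *-assoc _ _ _ ⟨
          g r * X * w^ r i j
            ≈⟨ *-congʳ (gX r) ⟩
          (X * g r + Y * (shift g r * X)) * w^ r i j
            ≈⟨ distribʳ _ _ _ ⟩
          X * g r * w^ r i j + Y * (shift g r * X) * w^ r i j
            ≈⟨ +-cong (*-assoc _ _ _) (trans (*-assoc _ _ _) (*-congˡ (trans (*-assoc _ _ _)
                 (trans (*-congˡ (commutes-w^ Xδ r i j)) (sym (*-assoc _ _ _)))))) ⟩
          X * (g r * w^ r i j) + Y * (u r * X) ∎

      product : Series
      product i j = g i * g j

      commutes-product : ∀ i j → Commutes (product i j) δ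
      commutes-product i j = sym (commutes-* (sym (gδ i)) (sym (gδ j)))

      -- The relation `gX` is used first for the right factor and then for the left one. The Y left
      -- between the factors is moved to the front by `aY`, and `tail` rewrites the resulting cross
      -- terms so that every term ends in X.
      product-X : ∀ i j → product i j * X ≈ X * product i j + Y * ((W product) i j * X)
      product-X i j = begin
        a * b * X
          ≈⟨ trans (*-assoc a b X) (*-congˡ (gX j)) ⟩
        a * (X * b + Y * (b′ * X))
          ≈⟨ trans (distribˡ a _ _) (sym (+-cong (*-assoc a X b) (*-assoc a Y _))) ⟩
        a * X * b + a * Y * (b′ * X)
          ≈⟨ +-cong (*-congʳ (gX i)) (*-congʳ aY) ⟩
        (X * a + Y * (a′ * X)) * b + Y * (a + a′ * X) * (b′ * X)
          ≈⟨ +-cong (trans (distribʳ b _ _) (+-cong (*-assoc X a b) (*-assoc Y _ b))) (*-assoc Y _ _) ⟩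
        X * (a * b) + Y * (a′ * X * b) + Y * ((a + a′ * X) * (b′ * X))
          ≈⟨ trans (+-assoc _ _ _) (+-congˡ (sym (distribˡ Y _ _))) ⟩
        X * (a * b) + Y * (a′ * X * b + (a + a′ * X) * (b′ * X))
          ≈⟨ +-congˡ (*-congˡ (trans (+-congˡ (distribʳ _ a _)) (sym (+-assoc _ _ _)))) ⟩
        X * (a * b) + Y * (a′ * X * b + a * (b′ * X) + a′ * X * (b′ * X))
          ≈⟨ +-congˡ (*-congˡ (trans (+-congʳ (+-comm _ _)) (+-assoc _ _ _))) ⟩
        X * (a * b) + Y * (a * (b′ * X) + (a′ * X * b + a′ * X * (b′ * X)))
          ≈⟨ +-congˡ (*-congˡ (+-cong (sym (*-assoc a b′ X)) tail)) ⟩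
        X * (a * b) + Y * (a * b′ * X + (a′ * b * X + - δ * (a′ * b′) * X))
          ≈⟨ +-congˡ (*-congˡ (trans (+-congˡ (sym (distribʳ X _ _))) (sym (distribʳ X _ _)))) ⟩
        X * (a * b) + Y * ((a * b′ + (a′ * b + - δ * (a′ * b′))) * X)
          ≈⟨ +-congˡ (*-congˡ (*-congʳ (trans (sym (+-assoc _ _ _)) (trans (+-congʳ (+-comm _ _)) (+-assoc _ _ _))))) ⟩
        X * (a * b) + Y * ((a′ * b + (a * b′ + - δ * (a′ * b′))) * X)
          ≈⟨ +-congˡ (*-congˡ (*-congʳ (+-cong (shift-*ʳ b g i) (+-cong (shift-*ˡ a g j)
               (*-congˡ (trans (shift-cong (λ k → shift-*ˡ (g k) g j) i) (shift-*ʳ b′ g i))))))) ⟨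
        X * product i j + Y * ((W product) i j * X) ∎
        where
        a = g i
        b = g j
        a′ = shift g i
        b′ = shift g j
        a′δ : Commutes a′ (- δ)
        a′δ = commutes-neg (sym (commutes-shift g (λ k → sym (gδ k)) i))
        -- Y differs from X by δ, which commutes with a, so `gX` also governs a * Y.
        aY : a * Y ≈ Y * (a + a′ * X)
        aY = begin
          a * Y                             ≈⟨ trans (*-congˡ Y≈X+δ) (distribˡ a X δ) ⟩
          a * X + a * δ                     ≈⟨ +-cong (gX i) (gδ i) ⟩
          X * a + Y * (a′ * X) + δ * a      ≈⟨ trans (+-assoc _ _ _) (trans (+-congˡ (+-comm _ _)) (sym (+-assoc _ _ _))) ⟩
          X * a + δ * a + Y * (a′ * X)      ≈⟨ +-congʳ (trans (*-congʳ Y≈X+δ) (distribʳ a X δ)) ⟨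
          Y * a + Y * (a′ * X)              ≈⟨ distribˡ Y _ _ ⟨
          Y * (a + a′ * X)                  ∎
        X≈Y-δ : X ≈ Y + - δ
        X≈Y-δ = sym (trans (+-congʳ Y≈X+δ) (trans (+-assoc _ _ _)
          (trans (+-congˡ (-‿inverseʳ δ)) (+-identityʳ X))))
        -- The term -δzv of w originates here: `gX` needs Y in front of b′ * X, and replacing X by Y
        -- - δ leaves a correction by -δ.
        Xb+Xb′X : X * b + X * (b′ * X) ≈ b * X + - δ * (b′ * X)
        Xb+Xb′X = begin
          X * b + X * (b′ * X)                       ≈⟨ +-congˡ (trans (*-congʳ X≈Y-δ) (distribʳ _ Y (- δ))) ⟩
          X * b + (Y * (b′ * X) + - δ * (b′ * X))    ≈⟨ +-assoc _ _ _ ⟨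
          X * b + Y * (b′ * X) + - δ * (b′ * X)      ≈⟨ +-congʳ (gX j) ⟨
          b * X + - δ * (b′ * X)                     ∎
        tail : a′ * X * b + a′ * X * (b′ * X) ≈ a′ * b * X + - δ * (a′ * b′) * X
        tail = begin
          a′ * X * b + a′ * X * (b′ * X)        ≈⟨ +-cong (*-assoc _ _ _) (*-assoc _ _ _) ⟩
          a′ * (X * b) + a′ * (X * (b′ * X))    ≈⟨ distribˡ a′ _ _ ⟨
          a′ * (X * b + X * (b′ * X))           ≈⟨ *-congˡ Xb+Xb′X ⟩
          a′ * (b * X + - δ * (b′ * X))         ≈⟨ distribˡ a′ _ _ ⟩
          a′ * (b * X) + a′ * (- δ * (b′ * X))  ≈⟨ +-cong (*-assoc _ _ _) (trans (*-congʳ (sym a′δ)) (*-assoc _ _ _)) ⟨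
          a′ * b * X + - δ * a′ * (b′ * X)      ≈⟨ +-congˡ (trans (sym (*-assoc _ _ _)) (*-congʳ (*-assoc _ _ _))) ⟩
          a′ * b * X + - δ * (a′ * b′) * X      ∎

      -- Lets a truncation known to agree in lower degrees take the place of the product in the
      -- remainder, so that both obey a relation with the same remainder.
      product-X′ : ∀ {F} i j → (∀ a b → a ℕ.+ b ℕ.< i ℕ.+ j → product a b ≈ F a b) →
                   product i j * X ≈ X * product i j + Y * ((W F) i j * X)
      product-X′ i j eq = trans (product-X i j) (+-congˡ (*-congˡ (*-congʳ (W-cong i j eq))))

      -- The first factor vanishes at positive powers of v and the second at positive powers of z,
      -- so only the split (i , 0) + (0 , j) of the exponents survives.
      in-z*in-v : ∀ i j → (in-z g ⊛ in-v g) i j ≈ product i j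
      in-z*in-v i j = begin
        (in-z g ⊛ in-v g) i j
          ≈⟨ (sum-cong-≋ {suc i} λ a → trans
               (+-congˡ (trans (sum-cong-≋ {j} λ b → zeroˡ (in-v g (i ∸ toℕ a) (j ∸ suc (toℕ b))))
                               (sum-replicate-zero j)))
               (+-identityʳ (u (toℕ a)))) ⟩
        sum {suc i} (λ a → u (toℕ a))
          ≈⟨ ∑-def (suc i) u ⟨
        ∑ (suc i) u
          ≈⟨ ∑-snoc i u ⟩
        ∑ i u + g i * in-v g (i ∸ i) j
          ≈⟨ +-cong (∑-0 i λ a a<i → trans (*-congˡ (in-v-0 (ℕ.m<n⇒0<n∸m a<i))) (zeroʳ _))
                    (*-congˡ (reflexive (≡.cong (λ k → in-v g k j) (ℕ.n∸n≡0 i)))) ⟩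
        0# + g i * g j
          ≈⟨ +-identityˡ _ ⟩
        g i * g j ∎
        where
        u : ℕ → Carrier
        u a = g a * in-v g (i ∸ a) j
        in-v-0 : ∀ {m} → 0 ℕ.< m → in-v g m j ≈ 0#
        in-v-0 {suc m} _ = refl

      -- The series operations are kept abstract because instantiating them by
      -- unification matches the statement without unfolding any operator.
      module _
        (_≋_ : Series → Series → Set ℓ)
        (_+ˢ_ _-ˢ_ _*ˢ_ : Series → Series → Series)
        (_⟨_⟩ˢ : (ℕ → Carrier) → Series → Series)
        (constˢ : Carrier → Series) (zˢ vˢ : Series) (in-zˢ in-vˢ : (ℕ → Carrier) → Series)
        (pointwise : ∀ A B → (∀ i j → A i j ≈ B i j) → A ≋ B)
        (+≈ : ∀ A B i j → (A +ˢ B) i j ≈ A i j + B i j)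
        (-≈ : ∀ A B i j → (A -ˢ B) i j ≈ A i j - B i j)
        (*≈ : ∀ A B i j → (A *ˢ B) i j ≈ (A ⊛ B) i j)
        (⟨⟩≈ : ∀ f P i j → (f ⟨ P ⟩ˢ) i j ≈ (f ⟨ P ⟩) i j)
        (const≈ : ∀ a i j → constˢ a i j ≈ const a i j)
        (z≈ : ∀ i j → zˢ i j ≈ z i j) (v≈ : ∀ i j → vˢ i j ≈ v i j)
        (in-z≈ : ∀ f i j → in-zˢ f i j ≈ in-z f i j) (in-v≈ : ∀ f i j → in-vˢ f i j ≈ in-v f i j)
        where

        composition : (∀ N i j → i ℕ.+ j ℕ.< N → product i j ≈ partial N i j) →
          (in-zˢ g *ˢ in-vˢ g) ≋ (g ⟨ (zˢ +ˢ vˢ) -ˢ ((constˢ δ *ˢ zˢ) *ˢ vˢ) ⟩ˢ)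
        composition product≈partial = pointwise _ _ λ i j → begin
          (in-zˢ g *ˢ in-vˢ g) i j
            ≈⟨ trans (*≈ _ _ i j) (⊛-cong (in-z≈ g) (in-v≈ g) i j) ⟩
          (in-z g ⊛ in-v g) i j
            ≈⟨ in-z*in-v i j ⟩
          product i j
            -- The length suc (i + j) is the number of terms that the substitution sums in degree (i
            -- , j).
            ≈⟨ product≈partial (suc (i ℕ.+ j)) i j ℕ.≤-refl ⟩
          partial (suc (i ℕ.+ j)) i j
            ≈⟨ ∑-def (suc (i ℕ.+ j)) (λ r → g r * w^ r i j) ⟩
          (g ⟨ w ⟩) i j
            ≈⟨ (sum-cong-≋ {suc (i ℕ.+ j)} λ r → *-congˡ {g (toℕ r)} (^-cong P≈w (toℕ r) i j)) ⟨
          (g ⟨ (zˢ +ˢ vˢ) -ˢ ((constˢ δ *ˢ zˢ) *ˢ vˢ) ⟩) i j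
            ≈⟨ ⟨⟩≈ g _ i j ⟨
          (g ⟨ (zˢ +ˢ vˢ) -ˢ ((constˢ δ *ˢ zˢ) *ˢ vˢ) ⟩ˢ) i j ∎
          where
          δz≈ : ∀ i j → (constˢ δ *ˢ zˢ) i j ≈ δz i j
          δz≈ i j = trans (*≈ _ _ i j) (⊛-cong (const≈ δ) z≈ i j)
          P≈w : ∀ i j → ((zˢ +ˢ vˢ) -ˢ ((constˢ δ *ˢ zˢ) *ˢ vˢ)) i j ≈ w i j
          P≈w i j = trans (-≈ _ _ i j)
            (+-cong (trans (+≈ _ _ i j) (+-cong (z≈ i j) (v≈ i j)))
                    (-‿cong (trans (*≈ _ _ i j) (⊛-cong δz≈ v≈ i j))))

-- Weyl algebra relations and the recurrence for 𝒢ₙ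

module Weyl {c ℓ} (R : Ring c ℓ) where
  open Ring R hiding (zero)
  open Algebra.Definitions.RawSemiring (RawRing.rawSemiring rawRing) using (sum; _^_)
  open Algebra.Properties.Semiring.Mult semiring
  open Algebra.Properties.CommutativeMonoid.Mult +-commutativeMonoid using (×-distrib-+)
  open Algebra.Properties.Ring R
  open Algebra.Properties.Semiring.Sum semiring using (sum-cong-≋)
  open Relation.Binary.Reasoning.Setoid setoid
  open RingSums R

  y≈x+[y-x] : ∀ x y → y ≈ x + (y - x)
  y≈x+[y-x] x y = begin
    y                  ≈⟨ +-identityʳ y ⟨
    y + 0#             ≈⟨ +-congˡ (-‿inverseˡ x) ⟨
    y + (- x + x)      ≈⟨ +-assoc y (- x) x ⟨
    y - x + x          ≈⟨ +-comm _ x ⟩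
    x + (y - x)        ∎

  derivation-+ˡ : ∀ {D E X} → D * X ≈ X * D + 1# → E * X ≈ X * E → (D + E) * X ≈ X * (D + E) + 1#
  derivation-+ˡ {D} {E} {X} DX EX = begin
    (D + E) * X            ≈⟨ distribʳ X D E ⟩
    D * X + E * X          ≈⟨ +-cong DX EX ⟩
    X * D + 1# + X * E     ≈⟨ trans (+-assoc _ _ _) (trans (+-congˡ (+-comm _ _)) (sym (+-assoc _ _ _))) ⟩
    X * D + X * E + 1#     ≈⟨ +-congʳ (distribˡ X D E) ⟨
    X * (D + E) + 1#       ∎

  derivation-+ʳ : ∀ {D E X} → D * X ≈ X * D → E * X ≈ X * E + 1# → (D + E) * X ≈ X * (D + E) + 1#
  derivation-+ʳ {D} {E} {X} DX EX = begin
    (D + E) * X            ≈⟨ distribʳ X D E ⟩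
    D * X + E * X          ≈⟨ +-cong DX EX ⟩
    X * D + (X * E + 1#)   ≈⟨ +-assoc _ _ _ ⟨
    X * D + X * E + 1#     ≈⟨ +-congʳ (distribˡ X D E) ⟨
    X * (D + E) + 1#       ∎

  commutes-difference : ∀ {a b c} → Commutes a b → Commutes a c → Commutes a (c - b)
  commutes-difference ab ac = commutes-+ ac (commutes-neg ab)

  -- The two commutators equal 1 and cancel; this is D(y - x) = 0.
  derivation-difference : ∀ {D X Y} → D * X ≈ X * D + 1# → D * Y ≈ Y * D + 1# → Commutes D (Y - X)
  derivation-difference {D} {X} {Y} DX DY = begin
    D * (Y - X)                          ≈⟨ x[y-z]≈xy-xz D Y X ⟩
    D * Y - D * X                        ≈⟨ +-cong DY (-‿cong DX) ⟩
    (Y * D + 1#) - (X * D + 1#)          ≈⟨ +-congˡ (trans (-‿cong (+-comm _ _)) (sym (-‿+-comm 1# (X * D)))) ⟩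
    (Y * D + 1#) + (- 1# + - (X * D))    ≈⟨ trans (+-assoc _ _ _) (+-congˡ (sym (+-assoc _ _ _))) ⟩
    Y * D + ((1# - 1#) + - (X * D))      ≈⟨ +-congˡ (trans (+-congʳ (-‿inverseʳ 1#)) (+-identityˡ _)) ⟩
    Y * D - X * D                        ≈⟨ [y-z]x≈yx-zx D Y X ⟨
    (Y - X) * D                          ∎

  commutes-× : ∀ {a b} n → Commutes a b → Commutes a (n × b)
  commutes-× {a} {b} n ab = trans (×-comm-* n a b) (trans (×-congʳ n ab) (sym (×-assoc-* n b a)))

  commutes-^ : ∀ {a b} → Commutes a b → ∀ n → Commutes a (b ^ n)
  commutes-^ {a} p zero    = commutes-1 a
  commutes-^     p (suc n) = commutes-* p (commutes-^ p n)

  -- The derivative of a power of D with respect to D, stated for exponent n + 1 so that no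
  -- predecessor occurs.
  ^-suc-* : ∀ {X D} → D * X ≈ X * D + 1# →
            ∀ n → D ^ suc n * X ≈ X * D ^ suc n + suc n × D ^ n
  ^-suc-* {X} {D} DX zero = begin
    D * 1# * X             ≈⟨ *-congʳ (*-identityʳ D) ⟩
    D * X                  ≈⟨ DX ⟩
    X * D + 1#             ≈⟨ +-cong (*-congˡ (*-identityʳ D)) (+-identityʳ 1#) ⟨
    X * (D * 1#) + 1 × 1#  ∎
  ^-suc-* {X} {D} DX (suc n) = begin
    D * Dⁿ⁺¹ * X
      ≈⟨ *-assoc _ _ _ ⟩
    D * (Dⁿ⁺¹ * X)
      ≈⟨ *-congˡ (^-suc-* DX n) ⟩
    D * (X * Dⁿ⁺¹ + suc n × D ^ n)
      ≈⟨ distribˡ _ _ _ ⟩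
    D * (X * Dⁿ⁺¹) + D * (suc n × D ^ n)
      ≈⟨ +-cong (trans (sym (*-assoc _ _ _)) (*-congʳ DX)) (×-comm-* (suc n) D (D ^ n)) ⟩
    (X * D + 1#) * Dⁿ⁺¹ + suc n × Dⁿ⁺¹
      ≈⟨ +-congʳ (trans (distribʳ _ _ _) (+-cong (*-assoc _ _ _) (*-identityˡ _))) ⟩
    X * (D * Dⁿ⁺¹) + Dⁿ⁺¹ + suc n × Dⁿ⁺¹
      ≈⟨ +-assoc _ _ _ ⟩
    X * (D * Dⁿ⁺¹) + suc (suc n) × Dⁿ⁺¹ ∎
    where Dⁿ⁺¹ = D ^ suc n

  -- One factor X is pulled to the front of both terms, so that the correction is again normally
  -- ordered, with exponents n.
  normal-ordered-X : ∀ {X D} → D * X ≈ X * D + 1# → ∀ n →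
    X ^ suc n * D ^ suc n * X ≈ X * (X ^ suc n * D ^ suc n + suc n × (X ^ n * D ^ n))
  normal-ordered-X {X} {D} DX n = begin
    X ^ suc n * D ^ suc n * X
      ≈⟨ trans (*-assoc _ _ _) (*-congˡ (^-suc-* DX n)) ⟩
    X ^ suc n * (X * D ^ suc n + suc n × D ^ n)
      ≈⟨ distribˡ _ _ _ ⟩
    X ^ suc n * (X * D ^ suc n) + X ^ suc n * (suc n × D ^ n)
      ≈⟨ +-cong (trans (sym (*-assoc _ _ _)) (trans (*-congʳ (sym (commutes-^ refl (suc n)))) (*-assoc _ _ _)))
                (trans (*-assoc _ _ _) (*-congˡ (×-comm-* (suc n) _ _))) ⟩
    X * (X ^ suc n * D ^ suc n) + X * (suc n × (X ^ n * D ^ n))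
      ≈⟨ distribˡ _ _ _ ⟨
    X * (X ^ suc n * D ^ suc n + suc n × (X ^ n * D ^ n)) ∎

  -- scale n stands for the action of the scalar 1/n!, which R itself need not contain.
  module Recurrence
    {X Y D : Carrier} (XY : Commutes X Y)
    (DX : D * X ≈ X * D + 1#) (DY : D * Y ≈ Y * D + 1#)
    (scale : ℕ → Carrier → Carrier)
    (scale-cong : ∀ n {a b} → a ≈ b → scale n a ≈ scale n b)
    (scale-+ : ∀ n a b → scale n (a + b) ≈ scale n a + scale n b)
    (scale-*ˡ : ∀ n a b → scale n (a * b) ≈ scale n a * b)
    (scale-*ʳ : ∀ n a b → scale n (a * b) ≈ a * scale n b)
    (scale-0 : scale 0 1# ≈ 1#)
    (scale-suc : ∀ n a → scale (suc n) (suc n × a) ≈ scale n a)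
    where

    -- With `scale k` read as 1/k!, this is the binomial coefficient "XD choose k" of the Euler
    -- operator XD.
    T : ℕ → Carrier
    T k = scale k (X ^ k * D ^ k)

    T-0 : T 0 ≈ 1#
    T-0 = trans (scale-cong 0 (*-identityˡ 1#)) scale-0

    -- The factor k + 1 produced by normal ordering turns 1/(k+1)! into 1/k!.
    T-X : ∀ k → T (suc k) * X ≈ X * (T (suc k) + T k)
    T-X k = begin
      T (suc k) * X
        ≈⟨ scale-*ˡ (suc k) _ X ⟨
      scale (suc k) (X ^ suc k * D ^ suc k * X)
        ≈⟨ scale-cong (suc k) (normal-ordered-X DX k) ⟩
      scale (suc k) (X * (X ^ suc k * D ^ suc k + suc k × (X ^ k * D ^ k)))
        ≈⟨ scale-*ʳ (suc k) X _ ⟩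
      X * scale (suc k) (X ^ suc k * D ^ suc k + suc k × (X ^ k * D ^ k))
        ≈⟨ *-congˡ (trans (scale-+ (suc k) _ _) (+-congˡ (scale-suc k _))) ⟩
      X * (T (suc k) + T k) ∎

    -- The cofactor of Yⁿ in 𝒢ₙ. The case 0 is separate because `S (suc n)` uses row n of Pascal's
    -- triangle.
    S : ℕ → Carrier
    S zero    = 1#
    S (suc n) = binomial n λ k → T (suc k)

    -- Applying `T-X` to each term leaves the remainder X * `binomial n T`, with indices one lower
    -- than in `S (suc n)`; `previous` identifies it as `S n` * X.
    S-X : ∀ n → S (suc n) * X ≈ X * S (suc n) + S n * X
    S-X n = trans (step n) (trans (distribˡ X _ _) (+-congˡ (previous n)))
      where
      step : ∀ n → S (suc n) * X ≈ X * (S (suc n) + binomial n T)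
      step n = begin
        S (suc n) * X                                ≈⟨ binomial-* n X _ ⟩
        binomial n (λ k → T (suc k) * X)             ≈⟨ binomial-cong n T-X ⟩
        binomial n (λ k → X * (T (suc k) + T k))     ≈⟨ *-binomial n X _ ⟨
        X * binomial n (λ k → T (suc k) + T k)       ≈⟨ *-congˡ (binomial-+ n _ _) ⟩
        X * (S (suc n) + binomial n T)               ∎
      previous : ∀ n → X * binomial n T ≈ S n * X
      previous zero = begin
        X * binomial 0 T    ≈⟨ *-congˡ (trans (∑-snoc 0 _) (trans (+-congʳ (∑-0 0 λ _ ())) (+-identityˡ _))) ⟩
        X * (1 × T 0)       ≈⟨ *-congˡ (trans (×-homo-1 (T 0)) T-0) ⟩
        X * 1#              ≈⟨ commutes-1 X ⟩
        1# * X              ∎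
      -- Pascal's rule turns row n + 1 into the bracket on the right of `step n`, which is then read
      -- backwards.
      previous (suc n) = begin
        X * binomial (suc n) T          ≈⟨ *-congˡ (trans (binomial-suc n T) (+-comm _ _)) ⟩
        X * (S (suc n) + binomial n T)  ≈⟨ step n ⟨
        S (suc n) * X                   ∎

    Y^S-X : ∀ n → Y ^ n * S n * X ≈ X * (Y ^ n * S n) + Y * (shift (λ k → Y ^ k * S k) n * X)
    Y^S-X zero = begin
      1# * 1# * X                    ≈⟨ *-congʳ (*-identityˡ 1#) ⟩
      1# * X                         ≈⟨ commutes-1 X ⟨
      X * 1#                         ≈⟨ *-congˡ (*-identityˡ 1#) ⟨
      X * (1# * 1#)                  ≈⟨ +-identityʳ _ ⟨
      X * (1# * 1#) + 0#             ≈⟨ +-congˡ (trans (*-congˡ (zeroˡ X)) (zeroʳ Y)) ⟨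
      X * (1# * 1#) + Y * (0# * X)   ∎
    Y^S-X (suc n) = begin
      Yⁿ⁺¹ * S (suc n) * X
        ≈⟨ trans (*-assoc _ _ _) (*-congˡ (S-X n)) ⟩
      Yⁿ⁺¹ * (X * S (suc n) + S n * X)
        ≈⟨ distribˡ _ _ _ ⟩
      Yⁿ⁺¹ * (X * S (suc n)) + Yⁿ⁺¹ * (S n * X)
        ≈⟨ +-cong (trans (sym (*-assoc _ _ _)) (trans (*-congʳ (sym (commutes-^ XY (suc n)))) (*-assoc _ _ _)))
                  (trans (*-assoc _ _ _) (*-congˡ (sym (*-assoc _ _ _)))) ⟩
      X * (Yⁿ⁺¹ * S (suc n)) + Y * (Y ^ n * S n * X) ∎
      where Yⁿ⁺¹ = Y ^ suc n

    -- The shape in which `𝒢 (suc n)` is defined, with the summands left as a parameter; `u≈`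
    -- relates them to `T` afterwards.
    closed-form : (ℕ → ℕ → Carrier) → ℕ → Carrier
    closed-form u n = Y ^ suc n * sum {suc n} (λ k → u n (toℕ k))

    module _ {g : ℕ → Carrier} (u : ℕ → ℕ → Carrier)
             (g-0 : g 0 ≈ 1#) (g-suc : ∀ n → g (suc n) ≈ closed-form u n)
             (u≈ : ∀ n k → u n k ≈ (n C k) × T (suc k)) where

      g≈Y^S : ∀ n → g n ≈ Y ^ n * S n
      g≈Y^S zero    = trans g-0 (sym (*-identityˡ 1#))
      g≈Y^S (suc n) = trans (g-suc n) (*-congˡ
        (trans (sym (∑-def (suc n) (u n))) (∑-cong (suc n) (u≈ n))))

      recurrence-X : ∀ n → g n * X ≈ X * g n + Y * (shift g n * X)
      recurrence-X n = begin
        g n * X                          ≈⟨ *-congʳ (g≈Y^S n) ⟩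
        Y ^ n * S n * X                  ≈⟨ Y^S-X n ⟩
        X * (Y ^ n * S n) + Y * (shift (λ k → Y ^ k * S k) n * X)
          ≈⟨ +-cong (*-congˡ (g≈Y^S n)) (*-congˡ (*-congʳ (shift-cong g≈Y^S n))) ⟨
        X * g n + Y * (shift g n * X)    ∎

      -- Y - X commutes with X, Y and D, from which `g n` is built, and the scalars pass through
      -- products.
      commutes-Y-X : ∀ n → Commutes (g n) (Y - X)
      commutes-Y-X n = begin
        g n * d            ≈⟨ *-congʳ (g≈Y^S n) ⟩
        Y ^ n * S n * d    ≈⟨ commutes-* (commutes-^ dY n) (dS n) ⟨
        d * (Y ^ n * S n)  ≈⟨ *-congˡ (g≈Y^S n) ⟨
        d * g n            ∎
        where
        d = Y - X
        dX : Commutes d X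
        dX = sym (commutes-difference refl XY)
        dY : Commutes d Y
        dY = sym (commutes-difference (sym XY) refl)
        dD : Commutes d D
        dD = sym (derivation-difference DX DY)
        dS : ∀ n → Commutes d (S n)
        dS zero    = commutes-1 d
        dS (suc n) = commutes-∑ (suc n) λ k → commutes-× (n C k) (begin
          d * T (suc k)                              ≈⟨ scale-*ʳ (suc k) d _ ⟨
          scale (suc k) (d * (X ^ suc k * D ^ suc k))
            ≈⟨ scale-cong (suc k) (commutes-* (commutes-^ dX (suc k)) (commutes-^ dD (suc k))) ⟩
          scale (suc k) (X ^ suc k * D ^ suc k * d)  ≈⟨ scale-*ˡ (suc k) _ d ⟩
          T (suc k) * d                              ∎)

-- Arithmetic of fractions and of natural numbers in ℚ

/-cross : ∀ {a b} m n .{{_ : NonZero m}} .{{_ : NonZero n}} →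
          a ℕ.* n ≡ b ℕ.* m → + a / m ≡ + b / n
/-cross {a} {b} (suc m) (suc n) eq = ℚ.fromℚᵘ-cong {ℚᵘ.mkℚᵘ (+ a) m} {ℚᵘ.mkℚᵘ (+ b) n} (ℚᵘ.*≡* (begin
  + a ℤ.* + suc n    ≡⟨ ℤ.pos-* a (suc n) ⟨
  + (a ℕ.* suc n)    ≡⟨ ≡.cong +_ eq ⟩
  + (b ℕ.* suc m)    ≡⟨ ℤ.pos-* b (suc m) ⟩
  + b ℤ.* + suc m    ∎))
  where open ≡.≡-Reasoning

/-*-/ : ∀ a b m n .{{_ : NonZero m}} .{{_ : NonZero n}} →
        (+ a / m) ℚ.* (+ b / n) ≡ (+ (a ℕ.* b) / (m ℕ.* n)) {{ℕ.m*n≢0 m n}}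
/-*-/ a b (suc m) (suc n) = ℚ.toℚᵘ-injective (begin
  ℚ.toℚᵘ ((+ a / suc m) ℚ.* (+ b / suc n))
    ≈⟨ ℚ.toℚᵘ-homo-* (+ a / suc m) (+ b / suc n) ⟩
  ℚ.toℚᵘ (+ a / suc m) ℚᵘ.* ℚ.toℚᵘ (+ b / suc n)
    ≈⟨ ℚᵘ.*-cong (ℚ.toℚᵘ-fromℚᵘ (ℚᵘ.mkℚᵘ (+ a) m)) (ℚ.toℚᵘ-fromℚᵘ (ℚᵘ.mkℚᵘ (+ b) n)) ⟩
  ℚᵘ.mkℚᵘ (+ a) m ℚᵘ.* ℚᵘ.mkℚᵘ (+ b) n
    ≡⟨ ≡.cong (λ k → ℚᵘ.mkℚᵘ k (n ℕ.+ m ℕ.* suc n)) (≡.sym (ℤ.pos-* a b)) ⟩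
  ℚᵘ.mkℚᵘ (+ (a ℕ.* b)) (n ℕ.+ m ℕ.* suc n)
    ≈⟨ ℚ.toℚᵘ-fromℚᵘ _ ⟨
  ℚ.toℚᵘ (+ (a ℕ.* b) / (suc m ℕ.* suc n)) ∎)
  where open Relation.Binary.Reasoning.Setoid ℚᵘ.≃-setoid

fromℕ-suc : ∀ n → fromℕ (suc n) ≡ 1ℚ ℚ.+ fromℕ n
fromℕ-suc n = ℚ.toℚᵘ-injective (begin
  ℚ.toℚᵘ (fromℕ (suc n))
    ≈⟨ ℚ.toℚᵘ-fromℚᵘ (ℚᵘ.mkℚᵘ (+ suc n) 0) ⟩
  ℚᵘ.mkℚᵘ (+ suc n) 0
    ≡⟨ ≡.cong (λ k → ℚᵘ.mkℚᵘ (ℤ.+ 1 ℤ.+ k) 0) (≡.sym (ℤ.*-identityʳ (+ n))) ⟩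
  ℚᵘ.1ℚᵘ ℚᵘ.+ ℚᵘ.mkℚᵘ (+ n) 0
    ≈⟨ ℚᵘ.+-congʳ ℚᵘ.1ℚᵘ (ℚ.toℚᵘ-fromℚᵘ (ℚᵘ.mkℚᵘ (+ n) 0)) ⟨
  ℚ.toℚᵘ 1ℚ ℚᵘ.+ ℚ.toℚᵘ (fromℕ n)
    ≈⟨ ℚ.toℚᵘ-homo-+ 1ℚ (fromℕ n) ⟨
  ℚ.toℚᵘ (1ℚ ℚ.+ fromℕ n) ∎)
  where open Relation.Binary.Reasoning.Setoid ℚᵘ.≃-setoid

-- The coefficient form of ∂x x = x ∂x + 1, and likewise for y.
fromℕ-suc-* : ∀ n q → fromℕ (suc n) ℚ.* q ≡ fromℕ n ℚ.* q ℚ.+ q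
fromℕ-suc-* n q = begin
  fromℕ (suc n) ℚ.* q            ≡⟨ ≡.cong (ℚ._* q) (fromℕ-suc n) ⟩
  (1ℚ ℚ.+ fromℕ n) ℚ.* q         ≡⟨ ℚ.*-distribʳ-+ q 1ℚ (fromℕ n) ⟩
  1ℚ ℚ.* q ℚ.+ fromℕ n ℚ.* q     ≡⟨ ≡.cong (ℚ._+ fromℕ n ℚ.* q) (ℚ.*-identityˡ q) ⟩
  q ℚ.+ fromℕ n ℚ.* q            ≡⟨ ℚ.+-comm q _ ⟩
  fromℕ n ℚ.* q ℚ.+ q            ∎
  where open ≡.≡-Reasoning

-- Induction on polynomials

private module Module = LeftModule ℚ[x,y]

1ᴾ : Poly
1ᴾ = poly one (1 , vanishes)
  where
  one : ℕ → ℕ → ℚ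
  one zero    zero    = 1ℚ
  one zero    (suc _) = 0ℚ
  one (suc _) _       = 0ℚ
  vanishes : ∀ i j → 1 ℕ.≤ i ℕ.+ j → one i j ≡ 0ℚ
  vanishes zero    (suc _) _ = ≡.refl
  vanishes (suc _) _       _ = ≡.refl

-- Induction on the degree bound, through f = f(0,0) + x f₁ + y f₂ with f₁ and f₂ of smaller bound.
Poly-induction : ∀ {p} (P : Poly → Set p) →
  (∀ {f g} → f ≈ᴾ g → P f → P g) →
  (∀ {f g} → P f → P g → P (f Module.+ᴹ g)) →
  (∀ c {f} → P f → P (c Module.*ₗ f)) →
  P 1ᴾ → (∀ {f} → P f → P (Operator.⟦ X ⟧ f)) → (∀ {f} → P f → P (Operator.⟦ Y ⟧ f)) →
  ∀ f → P f
Poly-induction P resp plus scale one x y (poly f (N , b)) = go N f b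
  where
  go : ∀ N f b → P (poly f (N , b))
  -- With bound 0 every coefficient vanishes, and the zero polynomial is 0 times 1.
  go zero f b = resp (ext λ i j → ≡.trans (ℚ.*-zeroˡ (coeff 1ᴾ i j)) (≡.sym (b i j ℕ.z≤n))) (scale 0ℚ one)
  go (suc N) f b = resp (ext eq)
    (plus (scale (f 0 0) one)
          (plus (x (go N f₁ λ i j le → b (suc i) j (ℕ.s≤s le))) (y (go N f₂ b₂))))
    where
    f₁ f₂ : ℕ → ℕ → ℚ
    f₁ i j = f (suc i) j
    -- Only pure powers of y go to f₂, so that each monomial is counted once.
    f₂ zero    j = f 0 (suc j)
    f₂ (suc i) j = 0ℚ
    b₂ : ∀ i j → N ℕ.≤ i ℕ.+ j → f₂ i j ≡ 0ℚ
    b₂ zero    j le = b 0 (suc j) (ℕ.s≤s le)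
    b₂ (suc i) j le = ≡.refl
    drop : ∀ {p q} → q ≡ p → f 0 0 ℚ.* 0ℚ ℚ.+ q ≡ p
    drop {p} {q} q≡p = ≡.trans (≡.cong (ℚ._+ q) (ℚ.*-zeroʳ (f 0 0))) (≡.trans (ℚ.+-identityˡ q) q≡p)
    eq : ∀ i j → _ ≡ f i j
    eq zero    zero    = ≡.trans (ℚ.+-identityʳ _) (ℚ.*-identityʳ (f 0 0))
    eq zero    (suc j) = drop (ℚ.+-identityˡ _)
    eq (suc i) zero    = drop (ℚ.+-identityʳ _)
    eq (suc i) (suc j) = drop (ℚ.+-identityʳ _)

-- The operators x, y, D and 𝒢ₙ on polynomials

module OnPolynomials where
  open Operator using (Op; ⟦_⟧; _·_; id; ext; at)
  open Ring Operator.ring hiding (zero)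
  open Algebra.Definitions.RawSemiring (RawRing.rawSemiring rawRing) using (sum; _^_)
  open Algebra.Properties.Semiring.Mult semiring using (_×_)
  open Weyl Operator.ring
  open Substitution Operator.ring δ

  XY : Commutes X Y
  XY = ext λ f → ext λ { zero zero → ≡.refl ; zero (suc j) → ≡.refl ; (suc i) zero → ≡.refl ; (suc i) (suc j) → ≡.refl }

  ∂x-X : ∂x * X ≈ X * ∂x + 1#
  ∂x-X = ext λ f → ext λ
    { zero    j → ≡.trans (fromℕ-suc-* 0 (coeff f 0 j)) (≡.cong (ℚ._+ coeff f 0 j) (ℚ.*-zeroˡ (coeff f 0 j)))
    ; (suc i) j → fromℕ-suc-* (suc i) (coeff f (suc i) j) }

  ∂y-Y : ∂y * Y ≈ Y * ∂y + 1#
  ∂y-Y = ext λ f → ext λ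
    { i zero    → ≡.trans (fromℕ-suc-* 0 (coeff f i 0)) (≡.cong (ℚ._+ coeff f i 0) (ℚ.*-zeroˡ (coeff f i 0)))
    ; i (suc j) → fromℕ-suc-* (suc j) (coeff f i (suc j)) }

  ∂x-Y : ∂x * Y ≈ Y * ∂x
  ∂x-Y = ext λ f → ext λ { i zero → ℚ.*-zeroʳ (fromℕ (suc i)) ; i (suc j) → ≡.refl }

  ∂y-X : ∂y * X ≈ X * ∂y
  ∂y-X = ext λ f → ext λ { zero j → ℚ.*-zeroʳ (fromℕ (suc j)) ; (suc i) j → ≡.refl }

  D-X : D * X ≈ X * D + 1#
  D-X = derivation-+ˡ {∂x} {∂y} {X} ∂x-X ∂y-X

  D-Y : D * Y ≈ Y * D + 1#
  D-Y = derivation-+ʳ {∂x} {∂y} {Y} ∂x-Y ∂y-Y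

  Y≈X+δ : Y ≈ X + δ
  Y≈X+δ = y≈x+[y-x] X Y

  Xδ : Commutes X δ
  Xδ = commutes-difference {X} {X} {Y} refl XY

  ·-cong : ∀ {p q A B} → p ≡ q → A ≈ B → p · A ≈ q · B
  ·-cong p≡q A≈B = ext λ f → ext λ i j → ≡.cong₂ ℚ._*_ p≡q (_≈ᴾ_.at (at A≈B f) i j)

  -- Links the integer multiples of the ring lemmas to the rational scalars in the definition of
  -- `𝒢`.
  ×-· : ∀ n A → n × A ≈ fromℕ n · A
  ×-· zero    A = ext λ f → ext λ i j → ≡.sym (ℚ.*-zeroˡ (coeff (⟦ A ⟧ f) i j))
  ×-· (suc n) A = ext λ f → ext λ i j → let a = coeff (⟦ A ⟧ f) i j in
    ≡.trans (≡.cong (a ℚ.+_) (_≈ᴾ_.at (at (×-· n A) f) i j))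
            (≡.trans (ℚ.+-comm a _) (≡.sym (fromℕ-suc-* n a)))

  ·-distrib-+ : ∀ p A B → p · (A + B) ≈ p · A + p · B
  ·-distrib-+ p A B = ext λ f → Module.*ₗ-distribˡ p (⟦ A ⟧ f) (⟦ B ⟧ f)

  ·-* : ∀ p A B → p · (A * B) ≈ (p · A) * B
  ·-* p A B = ext λ f → ext λ i j → ≡.refl

  *-· : ∀ p A B → p · (A * B) ≈ A * (p · B)
  *-· p A B = ext λ f → ext λ i j → ≡.sym (_≈ᴾ_.at (Op.*ₗ-homo A p (⟦ B ⟧ f)) i j)

  1/_! : ℕ → ℚ
  1/ n ! = (+ 1 / (n !)) {{n !≢0}}

  1/[1+n]!*[1+n] : ∀ n → 1/ (suc n) ! ℚ.* fromℕ (suc n) ≡ 1/ n !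
  1/[1+n]!*[1+n] n = ≡.trans (/-*-/ 1 (suc n) (suc n !) 1)
    (/-cross {1 ℕ.* suc n} {1} (suc n ! ℕ.* 1) (n !) (begin
      1 ℕ.* suc n ℕ.* n !       ≡⟨ ≡.cong (ℕ._* n !) (ℕ.*-identityˡ (suc n)) ⟩
      suc n !                   ≡⟨ ℕ.*-identityʳ (suc n !) ⟨
      suc n ! ℕ.* 1             ≡⟨ ℕ.*-identityˡ _ ⟨
      1 ℕ.* (suc n ! ℕ.* 1)     ∎))
    where
    open ≡.≡-Reasoning
    instance
      _ = suc n !≢0
      _ = n !≢0
      _ = ℕ.m*n≢0 (suc n !) 1

  1/[1+n]!-× : ∀ n A → 1/ (suc n) ! · (suc n × A) ≈ 1/ n ! · A
  1/[1+n]!-× n A = ext λ f → ext λ i j → begin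
    1/ (suc n) ! ℚ.* coeff (⟦ suc n × A ⟧ f) i j
      ≡⟨ ≡.cong (1/ (suc n) ! ℚ.*_) (_≈ᴾ_.at (at (×-· (suc n) A) f) i j) ⟩
    1/ (suc n) ! ℚ.* (fromℕ (suc n) ℚ.* coeff (⟦ A ⟧ f) i j)
      ≡⟨ ℚ.*-assoc (1/ (suc n) !) (fromℕ (suc n)) (coeff (⟦ A ⟧ f) i j) ⟨
    1/ (suc n) ! ℚ.* fromℕ (suc n) ℚ.* coeff (⟦ A ⟧ f) i j
      ≡⟨ ≡.cong (ℚ._* coeff (⟦ A ⟧ f) i j) (1/[1+n]!*[1+n] n) ⟩
    1/ n ! ℚ.* coeff (⟦ A ⟧ f) i j ∎
    where open ≡.≡-Reasoning

  open Recurrence {X} {Y} {D} XY D-X D-Y (λ n → 1/ n ! ·_)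
    (λ n → ·-cong ≡.refl)
    (λ n → ·-distrib-+ (1/ n !))
    (λ n → ·-* (1/ n !))
    (λ n → *-· (1/ n !))
    (ext λ f → Module.*ₗ-identityˡ f)
    1/[1+n]!-×

  -- Separates the binomial coefficient, which belongs to `binomial`, from the factorial, which
  -- belongs to `T`.
  𝒢-coefficient : ∀ n k → ((+ (n C k)) / (suc k !)) {{suc k !≢0}} ≡ fromℕ (n C k) ℚ.* 1/ (suc k) !
  𝒢-coefficient n k = ≡.sym (≡.trans (/-*-/ (n C k) 1 1 (suc k !))
    (/-cross {(n C k) ℕ.* 1} {n C k} (1 ℕ.* suc k !) (suc k !)
      (≡.trans (≡.cong (ℕ._* suc k !) (ℕ.*-identityʳ (n C k)))
               (≡.cong ((n C k) ℕ.*_) (≡.sym (ℕ.*-identityˡ (suc k !)))))))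
    where
    instance
      _ = suc k !≢0
      _ = ℕ.m*n≢0 1 (suc k !)

  sum-at : ∀ {n} {t u : Fin n → Op} {f} → (∀ k → ⟦ t k ⟧ f ≈ᴾ ⟦ u k ⟧ f) → ⟦ sum t ⟧ f ≈ᴾ ⟦ sum u ⟧ f
  sum-at {zero}          t≈u = ext λ i j → ≡.refl
  sum-at {suc n} {t} {u} t≈u = ext λ i j → ≡.cong₂ ℚ._+_ (_≈ᴾ_.at (t≈u Fin.zero) i j)
    (_≈ᴾ_.at (sum-at {n} {λ k → t (Fin.suc k)} {λ k → u (Fin.suc k)} λ k → t≈u (Fin.suc k)) i j)

  𝒢-term : ℕ → ℕ → Op
  𝒢-term n k = ((+ (n C k)) / (suc k !)) {{suc k !≢0}} · (X ^ suc k * D ^ suc k)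

  𝒢-term≈ : ∀ n k → 𝒢-term n k ≈ (n C k) × T (suc k)
  𝒢-term≈ n k = ext λ f → ext λ i j → let a = coeff (⟦ X ^ suc k * D ^ suc k ⟧ f) i j in
    ≡.trans (≡.cong (ℚ._* a) (𝒢-coefficient n k))
      (≡.trans (ℚ.*-assoc (fromℕ (n C k)) (1/ (suc k) !) a)
               (≡.sym (_≈ᴾ_.at (at (×-· (n C k) (T (suc k))) f) i j)))

  -- The two sides are convertible, but only their values are compared, term by
  -- term: unfolding equality of operators would compare the linearity proofs.
  𝒢-suc : ∀ n → 𝒢 (suc n) ≈ closed-form 𝒢-term n
  𝒢-suc n = ext λ f → Op.⟦⟧-cong Y (Op.⟦⟧-cong (Y ^ n) (ext λ i j →
    ≡.cong (coeff (⟦ 𝒢-term n 0 ⟧ f) i j ℚ.+_)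
      (_≈ᴾ_.at (sum-at {n} {_} {_} {f} λ k → ext λ i j → ≡.refl) i j)))

  𝒢-X : ∀ n → 𝒢 n * X ≈ X * 𝒢 n + Y * (shift 𝒢 n * X)
  𝒢-X = recurrence-X {𝒢} 𝒢-term (refl {id}) 𝒢-suc 𝒢-term≈

  𝒢δ : ∀ n → Commutes (𝒢 n) δ
  𝒢δ = commutes-Y-X {𝒢} 𝒢-term (refl {id}) 𝒢-suc 𝒢-term≈

  𝒢≈Y^S : ∀ n → 𝒢 n ≈ Y ^ n * S n
  𝒢≈Y^S = g≈Y^S {𝒢} 𝒢-term (refl {id}) 𝒢-suc 𝒢-term≈

  -- The left ideal of operators that annihilate the polynomial 1

  Kills1 : Op → Set
  Kills1 A = ∀ i j → coeff (⟦ A ⟧ 1ᴾ) i j ≡ 0ℚ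

  kills1-≈ : ∀ {A B} → A ≈ B → Kills1 B → Kills1 A
  kills1-≈ A≈B B1 i j = ≡.trans (_≈ᴾ_.at (at A≈B 1ᴾ) i j) (B1 i j)

  kills1-* : ∀ A B → Kills1 B → Kills1 (A * B)
  kills1-* A B B1 i j = ≡.trans (_≈ᴾ_.at (Op.⟦⟧-cong A {⟦ B ⟧ 1ᴾ} {Module.0ᴹ} (ext B1)) i j) (_≈ᴾ_.at (Op.0ᴹ-homo A) i j)

  kills1-· : ∀ p A → Kills1 A → Kills1 (p · A)
  kills1-· p A A1 i j = ≡.trans (≡.cong (p ℚ.*_) (A1 i j)) (ℚ.*-zeroʳ p)

  kills1-∑ : ∀ n (f : ℕ → Op) → (∀ k → Kills1 (f k)) → Kills1 (∑ n f)
  kills1-∑ zero    f f1 = _≈ᴾ_.at (at (∑-0 0 {f} λ _ ()) 1ᴾ)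
  kills1-∑ (suc n) f f1 = kills1-≈ {∑ (suc n) f} {∑ n f + f n} (∑-snoc n f) λ i j →
    ≡.cong₂ ℚ._+_ (kills1-∑ n f f1 i j) (f1 n i j)

  D-kills1 : Kills1 D
  D-kills1 zero    zero    = ≡.refl
  D-kills1 zero    (suc j) = ≡.cong₂ ℚ._+_ (ℚ.*-zeroʳ (fromℕ 1)) (ℚ.*-zeroʳ (fromℕ (2 ℕ.+ j)))
  D-kills1 (suc i) j       = ≡.cong₂ ℚ._+_ (ℚ.*-zeroʳ (fromℕ (2 ℕ.+ i))) (ℚ.*-zeroʳ (fromℕ (suc j)))

  D^-kills1 : ∀ n → Kills1 (D ^ suc n)
  D^-kills1 zero    i j = D-kills1 i j
  D^-kills1 (suc n) i j = kills1-* D (D ^ suc n) (D^-kills1 n) i j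

  T-kills1 : ∀ n → Kills1 (T (suc n))
  T-kills1 n i j = kills1-· (1/ (suc n) !) (X ^ suc n * D ^ suc n)
    (kills1-* (X ^ suc n) (D ^ suc n) (D^-kills1 n)) i j

  -- Every summand ends in a positive power of D, and D annihilates constants.
  𝒢-kills1 : ∀ n → Kills1 (𝒢 (suc n))
  𝒢-kills1 n = kills1-≈ {𝒢 (suc n)} {Y ^ suc n * S (suc n)} (𝒢≈Y^S (suc n))
    (kills1-* (Y ^ suc n) (S (suc n)) (kills1-∑ (suc n) (λ k → (n C k) × T (suc k)) λ k →
      kills1-≈ {(n C k) × T (suc k)} (×-· (n C k) (T (suc k))) (kills1-· (fromℕ (n C k)) (T (suc k)) (T-kills1 k))))

  -- The polynomials on which A and B agree form a subspace containing 1. It is closed under x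
  -- because both commutators with x equal Q, under δ by commutation, and hence under y = x + δ.
  Op-unique : ∀ {A B Q} → ⟦ A ⟧ 1ᴾ ≈ᴾ ⟦ B ⟧ 1ᴾ → Commutes A δ → Commutes B δ →
              A * X ≈ X * A + Q → B * X ≈ X * B + Q → A ≈ B
  Op-unique {A} {B} {Q} one Aδ Bδ AX BX = ext (Poly-induction P resp plus scale one x y)
    where
    module A = Op A
    module B = Op B
    open Relation.Binary.Reasoning.Setoid Module.≈ᴹ-setoid
    P : Poly → Set
    P f = ⟦ A ⟧ f ≈ᴾ ⟦ B ⟧ f
    resp : ∀ {f g} → f ≈ᴾ g → P f → P g
    resp f≈g p = Module.≈ᴹ-trans (A.⟦⟧-cong (Module.≈ᴹ-sym f≈g)) (Module.≈ᴹ-trans p (B.⟦⟧-cong f≈g))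
    plus : ∀ {f g} → P f → P g → P (f Module.+ᴹ g)
    plus {f} {g} p q = begin
      ⟦ A ⟧ (f Module.+ᴹ g)            ≈⟨ A.+ᴹ-homo f g ⟩
      ⟦ A ⟧ f Module.+ᴹ ⟦ A ⟧ g        ≈⟨ Module.+ᴹ-cong p q ⟩
      ⟦ B ⟧ f Module.+ᴹ ⟦ B ⟧ g        ≈⟨ B.+ᴹ-homo f g ⟨
      ⟦ B ⟧ (f Module.+ᴹ g)            ∎
    scale : ∀ c {f} → P f → P (c Module.*ₗ f)
    scale c {f} p = begin
      ⟦ A ⟧ (c Module.*ₗ f)    ≈⟨ A.*ₗ-homo c f ⟩
      c Module.*ₗ ⟦ A ⟧ f      ≈⟨ ext (λ i j → ≡.cong (c ℚ.*_) (_≈ᴾ_.at p i j)) ⟩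
      c Module.*ₗ ⟦ B ⟧ f      ≈⟨ B.*ₗ-homo c f ⟨
      ⟦ B ⟧ (c Module.*ₗ f)    ∎
    x : ∀ {f} → P f → P (⟦ X ⟧ f)
    x {f} p = begin
      ⟦ A ⟧ (⟦ X ⟧ f)                      ≈⟨ at AX f ⟩
      ⟦ X ⟧ (⟦ A ⟧ f) Module.+ᴹ ⟦ Q ⟧ f    ≈⟨ ext (λ i j → ≡.cong (ℚ._+ coeff (⟦ Q ⟧ f) i j) (_≈ᴾ_.at (Op.⟦⟧-cong X p) i j)) ⟩
      ⟦ X ⟧ (⟦ B ⟧ f) Module.+ᴹ ⟦ Q ⟧ f    ≈⟨ at BX f ⟨
      ⟦ B ⟧ (⟦ X ⟧ f)                      ∎
    d : ∀ {f} → P f → P (⟦ δ ⟧ f)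
    d {f} p = begin
      ⟦ A ⟧ (⟦ δ ⟧ f)  ≈⟨ at Aδ f ⟩
      ⟦ δ ⟧ (⟦ A ⟧ f)  ≈⟨ Op.⟦⟧-cong δ p ⟩
      ⟦ δ ⟧ (⟦ B ⟧ f)  ≈⟨ at Bδ f ⟨
      ⟦ B ⟧ (⟦ δ ⟧ f)  ∎
    y : ∀ {f} → P f → P (⟦ Y ⟧ f)
    y {f} p = resp (Module.≈ᴹ-sym (at Y≈X+δ f)) (plus (x p) (d p))

  -- For r ≥ 1 the coefficients of wʳ can be moved to the left of 𝒢ᵣ, which then annihilates 1. What
  -- remains, on either side, is 1 in degree (0 , 0) and 0 elsewhere.
  partial-1 : ∀ N i j → ⟦ partial 𝒢 𝒢δ (suc N) i j ⟧ 1ᴾ ≈ᴾ ⟦ 𝒢 i * 𝒢 j ⟧ 1ᴾ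
  partial-1 N i j = begin
    ⟦ partial 𝒢 𝒢δ (suc N) i j ⟧ 1ᴾ
      -- The summand r = 0 acts as `w^ 0 i j`, because `𝒢 0` is the identity.
      ≈⟨ at (∑-suc N (λ r → 𝒢 r * w^ r i j)) 1ᴾ ⟩
    ⟦ w^ 0 i j + ∑ N u ⟧ 1ᴾ
      ≈⟨ ext (λ a b → ≡.trans (≡.cong (coeff (⟦ w^ 0 i j ⟧ 1ᴾ) a b ℚ.+_) (kills1-∑ N u u-kills1 a b))
                              (ℚ.+-identityʳ _)) ⟩
    ⟦ w^ 0 i j ⟧ 1ᴾ
      ≈⟨ constant i j ⟩
    ⟦ 𝒢 i * 𝒢 j ⟧ 1ᴾ ∎
    where
    open Relation.Binary.Reasoning.Setoid Module.≈ᴹ-setoid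
    u : ℕ → Op
    u r = 𝒢 (suc r) * w^ (suc r) i j
    u-kills1 : ∀ r → Kills1 (u r)
    u-kills1 r = kills1-≈ {u r} {w^ (suc r) i j * 𝒢 (suc r)} (commutes-w^ {𝒢 (suc r)} (𝒢δ (suc r)) (suc r) i j)
      (kills1-* (w^ (suc r) i j) (𝒢 (suc r)) (𝒢-kills1 r))
    constant : ∀ i j → ⟦ w^ 0 i j ⟧ 1ᴾ ≈ᴾ ⟦ 𝒢 i * 𝒢 j ⟧ 1ᴾ
    constant zero    zero    = Module.≈ᴹ-refl
    constant zero    (suc j) = Module.≈ᴹ-sym (ext (𝒢-kills1 j))
    constant (suc i) zero    = Module.≈ᴹ-sym (ext (𝒢-kills1 i))
    constant (suc i) (suc j) = Module.≈ᴹ-sym (ext (kills1-* (𝒢 (suc i)) (𝒢 (suc j)) (𝒢-kills1 j)))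

  open Multiplication 𝒢 𝒢δ X Y Xδ Y≈X+δ 𝒢-X

  -- Induction on N. The remainder in the relation with x involves only coefficients of total degree
  -- below i + j ≤ N - 1, where the induction hypothesis makes the two series agree; `Op-unique`
  -- then concludes.
  product≈partial : ∀ N i j → i ℕ.+ j ℕ.< N → product i j ≈ partial 𝒢 𝒢δ N i j
  product≈partial (suc N) i j (ℕ.s≤s i+j≤N) =
    Op-unique {product i j} {partial 𝒢 𝒢δ (suc N) i j} {Y * ((W partial 𝒢 𝒢δ N) i j * X)}
      (Module.≈ᴹ-sym (partial-1 N i j))
      (commutes-product i j)
      (commutes-partial 𝒢 𝒢δ {δ} 𝒢δ (refl {δ * δ}) (suc N) i j)
      (product-X′ {partial 𝒢 𝒢δ N} i j λ a b a+b<i+j → product≈partial N a b (ℕ.≤-trans a+b<i+j i+j≤N))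
      (partial-X N i j)

  -- Matching the series operations of the statement

  const≈ : ∀ a i j → OpSeries.const a i j ≈ PowerSeries.const Operator.ring a i j
  const≈ a zero    zero    = refl {a}
  const≈ a zero    (suc j) = refl {0#}
  const≈ a (suc i) j       = refl {0#}

  z≈ : ∀ i j → OpSeries.z i j ≈ PowerSeries.z Operator.ring i j
  z≈ zero          j       = refl {0#}
  z≈ 1             zero    = refl {1#}
  z≈ 1             (suc j) = refl {0#}
  z≈ (suc (suc i)) j       = refl {0#}

  v≈ : ∀ i j → OpSeries.v i j ≈ PowerSeries.v Operator.ring i j
  v≈ zero    zero          = refl {0#}
  v≈ zero    1             = refl {1#}
  v≈ zero    (suc (suc j)) = refl {0#}
  v≈ (suc i) j             = refl {0#}

  in-z≈ : ∀ f i j → OpSeries.in-z f i j ≈ PowerSeries.in-z Operator.ring f i j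
  in-z≈ f i zero    = refl {f i}
  in-z≈ f i (suc j) = refl {0#}

  in-v≈ : ∀ f i j → OpSeries.in-v f i j ≈ PowerSeries.in-v Operator.ring f i j
  in-v≈ f zero    j = refl {f j}
  in-v≈ f (suc i) j = refl {0#}

  pointwise : ∀ A B → (∀ i j → A i j ≈ B i j) → A OpSeries.≈ B
  pointwise A B A≈B = A≈B

  +≈ : ∀ A B i j → (A OpSeries.+ B) i j ≈ A i j + B i j
  +≈ A B i j = refl {A i j + B i j}

  -≈ : ∀ A B i j → (A OpSeries.- B) i j ≈ A i j - B i j
  -≈ A B i j = refl {A i j - B i j}

  *≈ : ∀ A B i j → (A OpSeries.* B) i j ≈ PowerSeries._*_ Operator.ring A B i j
  *≈ A B i j = refl {(A OpSeries.* B) i j}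

  ⟨⟩≈ : ∀ f P i j → (f OpSeries.⟨ P ⟩) i j ≈ PowerSeries._⟨_⟩ Operator.ring f P i j
  ⟨⟩≈ f P i j = refl {(f OpSeries.⟨ P ⟩) i j}

  composed = composition _ _ _ _ _ _ _ _ _ _
    pointwise +≈ -≈ *≈ ⟨⟩≈ const≈ z≈ v≈ in-z≈ in-v≈ product≈partial

open OpSeries

theorem7 : in-z 𝒢 * in-v 𝒢 ≈ 𝒢 ⟨ z + v - const δ * z * v ⟩
theorem7 = OnPolynomials.composed
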